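{- For every sufficiently small constant $\varepsilon>0$, every non-adaptive convexity tester (with parameter $\varepsilon$) with one-sided error for sets in $\{0,\pm1\}^n$ has query complexity at least $3^{\Omega(\sqrt n)}$. That is, there is $\varepsilon_0>0$ such that for every $\varepsilon\in(0,\varepsilon_0]$ there exist $c>0$ and $n_0$ such that for all $n\ge n_0$ every such tester makes at least $3^{c\sqrt n}$ queries.
   Context: A set $S\subseteq\{0,\pm1\}^n$ is convex if $S=\mathrm{Conv}(S)\cap\{0,\pm1\}^n$, where $\mathrm{Conv}(S)\subseteq\mathbb{R}^n$ is the convex hull. For $S,T\subseteq\{0,\pm1\}^n$, $\mathrm{dist}(S,T)=|S\,\Delta\,T|/3^n$; $S$ is $\varepsilon$-far from convex if $\mathrm{dist}(S,T)\ge\varepsilon$ for every convex $T\subseteq\{0,\pm1\}^n$. A convexity tester with one-sided error and parameter $\varepsilon$ is a randomized algorithm with membership-oracle access to an unknown $S\subseteq\{0,\pm1\}^n$ that accepts with probability $1$ if $S$ is convex, and rejects with probability at least $2/3$ if $S$ is $\varepsilon$-far from convex. It is non-adaptive if it chooses its set of queries before receiving the answers to any of the queries. The query complexity is the number of membership queries made. -}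

module Defs where

open import Level using (Level; _⊔_) renaming (suc to lsuc)
open import Algebra.Bundles using (CommutativeRing)
import Algebra.Definitions.RawMonoid as RawMonoidDefs
open import Data.Bool.Base using (Bool; not; T; if_then_else_; _xor_)
open import Data.Fin.Base using (Fin)
open import Data.List.Base as List using (List; []; _∷_)
open import Data.Nat.Base as ℕ using (ℕ; zero; suc)
open import Data.Product.Base using (∃; _×_)
open import Data.Vec.Base as Vec using (Vec; []; _∷_)
open import Data.Vec.Functional as Vector using (Vector)
open import Function.Base using (_∘_)
open import Function.Bundles using (_⇔_)
open import Relation.Binary.Core using (Rel)
open import Relation.Binary.Definitions using (Cotransitive)
open import Relation.Binary.Structures using (IsStrictPartialOrder)
open import Relation.Nullary.Negation using (¬_)

-- The real numbers, given axiomatically as an Archimedean, Cauchy-complete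
-- ordered field.  The axioms are phrased so that they hold constructively
-- (the order is cotransitive and tight rather than decidable); classically
-- they determine ℝ up to unique isomorphism.

record RealNumbers (c ℓ₁ ℓ₂ : Level) : Set (lsuc (c ⊔ ℓ₁ ⊔ ℓ₂)) where
  field
    commutativeRing : CommutativeRing c ℓ₁

  open CommutativeRing commutativeRing public
    using (Carrier; _≈_; _+_; _*_; -_; _-_; 0#; 1#)

  open RawMonoidDefs (CommutativeRing.+-rawMonoid commutativeRing) public
    using (sum)

  fromℕ : ℕ → Carrier
  fromℕ m = RawMonoidDefs._×_ (CommutativeRing.+-rawMonoid commutativeRing) m 1#

  infix 4 _<_ _≤_

  field
    _<_                  : Rel Carrier ℓ₂
    isStrictPartialOrder : IsStrictPartialOrder _≈_ _<_
    cotransitive         : Cotransitive _<_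
    tight                : ∀ x y → ¬ (x < y) → ¬ (y < x) → x ≈ y
    0<1                  : 0# < 1#
    +-monoˡ-<            : ∀ z {x y} → x < y → x + z < y + z
    *-pos                : ∀ {x y} → 0# < x → 0# < y → 0# < x * y
    inverse              : ∀ {x} → 0# < x → ∃ λ y → x * y ≈ 1#
    archimedean          : ∀ x → ∃ λ m → x < fromℕ m

  _≤_ : Rel Carrier ℓ₂
  x ≤ y = ¬ (y < x)

  Cauchy : (ℕ → Carrier) → Set (c ⊔ ℓ₂)
  Cauchy s = ∀ e → 0# < e →
    ∃ λ N → ∀ i j → N ℕ.≤ i → N ℕ.≤ j → s i - s j < e

  _⟶_ : (ℕ → Carrier) → Carrier → Set (c ⊔ ℓ₂)
  s ⟶ l = ∀ e → 0# < e →
    ∃ λ N → ∀ i → N ℕ.≤ i → (s i - l < e) × (l - s i < e)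

  field
    complete : ∀ s → Cauchy s → ∃ λ l → s ⟶ l

data Trit : Set where
  neg zer pos : Trit

Point : ℕ → Set
Point n = Vec Trit n

allPoints : ∀ n → List (Point n)
allPoints zero    = [] ∷ []
allPoints (suc n) =
  List.cartesianProductWith _∷_ (neg ∷ zer ∷ pos ∷ []) (allPoints n)

-- Subsets of {0,±1}ⁿ are represented by their membership oracles.
CubeSet : ℕ → Set
CubeSet n = Point n → Bool

infix 4 _∈_
_∈_ : ∀ {n} → Point n → CubeSet n → Set
x ∈ S = T (S x)

∣_△_∣ : ∀ {n} → CubeSet n → CubeSet n → ℕ
∣_△_∣ {n} S S′ = List.length (List.filterᵇ (λ x → S x xor S′ x) (allPoints n))

-- A deterministic non-adaptive algorithm: the queries are fixed in advance and
-- the verdict (true = accept) is a function of the answers only.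
record Deterministic (n : ℕ) : Set where
  field
    size    : ℕ
    queries : Vec (Point n) size
    decide  : Vec Bool size → Bool

  run : CubeSet n → Bool
  run S = decide (Vec.map S queries)

module _ {c ℓ₁ ℓ₂ : Level} (ℝ : RealNumbers c ℓ₁ ℓ₂) where
  open RealNumbers ℝ

  tritValue : Trit → Carrier
  tritValue neg = - 1#
  tritValue zer = 0#
  tritValue pos = 1#

  embed : ∀ {n} → Point n → Vector Carrier n
  embed x i = tritValue (Vec.lookup x i)

  -- Membership of p ∈ ℝⁿ in Conv(S): p is a finite convex combination of
  -- points of S.
  record Conv {n : ℕ} (S : CubeSet n) (p : Vector Carrier n) : Set (c ⊔ ℓ₁ ⊔ ℓ₂) where
    field
      {size}      : ℕ
      point       : Fin size → Point n
      point∈S     : ∀ j → point j ∈ S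
      coeff       : Vector Carrier size
      coeff≥0     : ∀ j → 0# ≤ coeff j
      coeff-sum   : sum coeff ≈ 1#
      combination : ∀ i → sum (λ j → coeff j * embed (point j) i) ≈ p i

  Convex : ∀ {n} → CubeSet n → Set (c ⊔ ℓ₁ ⊔ ℓ₂)
  Convex S = ∀ x → (x ∈ S) ⇔ Conv S (embed x)

  -- dist(S,S′) ≥ ε, multiplied through by 3ⁿ.
  Dist≥ : ∀ {n} → Carrier → CubeSet n → CubeSet n → Set ℓ₂
  Dist≥ {n} ε S S′ = ε * fromℕ (3 ℕ.^ n) ≤ fromℕ ∣ S △ S′ ∣

  FarFromConvex : ∀ {n} → Carrier → CubeSet n → Set (c ⊔ ℓ₁ ⊔ ℓ₂)
  FarFromConvex ε S = ∀ S′ → Convex S′ → Dist≥ ε S S′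

  -- A randomized non-adaptive algorithm is a probability distribution over
  -- deterministic ones.  Finite support is no restriction: for fixed n there
  -- are, up to order and repetition of queries, only finitely many of them.
  -- Weights are positive so that the worst case below ranges over outcomes
  -- that actually occur.
  record NonAdaptive (n : ℕ) : Set (c ⊔ ℓ₁ ⊔ ℓ₂) where
    field
      outcomes   : ℕ
      prob       : Vector Carrier outcomes
      prob>0     : ∀ j → 0# < prob j
      prob-sum   : sum prob ≈ 1#
      algorithm  : Fin outcomes → Deterministic n

    Pr : (Fin outcomes → Bool) → Carrier
    Pr event = sum (λ j → if event j then prob j else 0#)

    Pr[accepts] : CubeSet n → Carrier
    Pr[accepts] S = Pr (λ j → Deterministic.run (algorithm j) S)

    Pr[rejects] : CubeSet n → Carrier
    Pr[rejects] S = Pr (λ j → not (Deterministic.run (algorithm j) S))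

    queryComplexity : ℕ
    queryComplexity = Vector.foldr ℕ._⊔_ 0 (Deterministic.size ∘ algorithm)

  record OneSidedTester {n : ℕ} (ε : Carrier) (A : NonAdaptive n) :
      Set (c ⊔ ℓ₁ ⊔ ℓ₂) where
    open NonAdaptive A
    field
      accepts-convex : ∀ S → Convex S → Pr[accepts] S ≈ 1#
      -- Pr[rejects] S ≥ 2/3
      rejects-far    : ∀ S → FarFromConvex ε S →
                       fromℕ 2 ≤ fromℕ 3 * Pr[rejects] S

  -- q ≥ 3^(κ√n) for real κ ≥ 0.  As 3^(κ√n) is the supremum of 3^(a/b) over the
  -- rationals 0 ≤ a/b ≤ κ√n, this says: whenever a² ≤ κ²b²n, also 3ᵃ ≤ qᵇ.
  AtLeast3^√ : Carrier → ℕ → ℕ → Set ℓ₂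
  AtLeast3^√ κ n q = ∀ a b → .{{ℕ.NonZero b}} →
    fromℕ (a ℕ.* a) ≤ (κ * κ) * fromℕ (b ℕ.* b ℕ.* n) →
    3 ℕ.^ a ℕ.≤ q ℕ.^ b

{-# OPTIONS --safe #-}
module Submission where

-- The hard instances are truncated anti-slabs {x : |⟨v,x⟩| ≥ 5m} for random v ∈ {±1}ⁿ, m ≈ √n,
-- where points with too many nonzero entries are removed and points with too few are added.
--
-- Far: let z lie in the slab, in the middle layers.  Filling 10m zeros of z with the entries
-- of v, or of −v, gives two members whose midpoint z is not a member, so any convex set
-- differs from the anti-slab at one of the three points.  At least half of all z are of this
-- kind (Chebyshev), and counting the triples from each of their points, where the numbers of
-- choices C(n/3 ± O(√n), 10m) agree up to a constant, makes the distance a constant.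
--
-- Hard to detect: if a cube point z is a convex combination of cube points x, every x extends
-- z.  In the middle layers x then has at most 12m further nonzero entries, while some x must
-- satisfy |⟨v,x − z⟩| ≥ 5m, which for a given pair has probability 2^{−Ω(m)} over v (Chernoff).
-- If no pair of queries is of this kind, then each queried non-member is cut off from the
-- queried members by a half-space, so the answers agree with a convex set and a one-sided
-- tester must accept.  A union bound over the pairs of queries yields 2^{Ω(m)} queries.

open import Algebra.Bundles using (CommutativeRing)
import Algebra.Properties.Ring as RingProperties
import Algebra.Properties.Semiring.Mult as SemiringMult
import Algebra.Properties.Semiring.Sum as SemiringSum
open import Data.Bool.Base using (Bool; true; false; T; not; _xor_; if_then_else_)
open import Data.Fin.Base using (Fin; zero; suc)
open import Data.List.Base as List using (List; []; _∷_; _++_; length)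
open import Data.List.Membership.Propositional using (find; lose) renaming (_∈_ to _∈ₗ_)
open import Data.List.Properties using (length-++; length-map; map-∘; map-++)
open import Data.List.Relation.Unary.All as All using (All; []; _∷_; all?)
import Data.List.Relation.Unary.All.Properties as All
open import Data.List.Relation.Unary.Any using (here; there; any?)
open import Data.Nat.Base as ℕ using (ℕ; zero; suc; NonZero)
open import Data.Nat.Combinatorics using (_C_; nC1≡n; nCn≡1; k>n⇒nCk≡0; nCk+nC[k+1]≡[n+1]C[k+1])
import Data.Nat.Properties as ℕ
open import Data.Nat.Tactic.RingSolver using (solve-∀)
open import Data.Product.Base using (∃; _×_; _,_; proj₁; proj₂)
open import Data.Sum.Base as Sum using (_⊎_; inj₁; inj₂; [_,_]′)
open import Data.Vec.Base as Vec using (Vec; []; _∷_; head; tail)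
open import Data.Vec.Functional as Vector using (Vector)
open import Data.Vec.Properties using (length-toList)
open import Data.Vec.Relation.Unary.All using ([]; _∷_) renaming (All to VAll)
open import Function.Base using (_∘_; const)
open import Function.Bundles using (mk⇔; Equivalence)
open import Level using (Level)
open import Relation.Binary.PropositionalEquality as ≡ using (_≡_)
open import Relation.Binary.Structures using (IsStrictPartialOrder)
open import Relation.Nullary using (¬_; Dec; yes; no; ⌊_⌋; _×-dec_; _⊎-dec_)
open import Relation.Nullary.Decidable using (¬?; T?; toWitness; fromWitness)
open import Relation.Nullary.Negation using (contradiction)
open import Defs

-- The two truncations make the pairs of queries rare. In the untruncated anti-slab a member
-- extending z may have about n further nonzero entries, and ⟨v,x - z⟩ then reaches 5m, a bounded
-- number of standard deviations, with probability bounded away from 0. Among at most 12m new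
-- entries a drift of 5m is a large deviation. The numbers must suit both halves of the argument.
-- The slab has width 10m, so leaving it from any inside point in either direction takes 10m fills,
-- and a core point needs 10m layers beneath it. A further 2m layers around the mean n/3 of the zero
-- count, together with the half-width 5m, leave at least half of the cube in the core. This gives
-- 12m layers, and the Chernoff factor for 5m out of 12m is still below 2^(-m). The order of the
-- reals is not decidable, so all counting is done in ℕ: denominators are cleared, differences are
-- moved across inequalities, and ⟨v,x⟩ is replaced by the height n + ⟨v,x⟩. Reals enter only
-- through convex combinations, probabilities and the final constants.

module Combinatorics where
  open import Data.Nat.Base
  open import Data.Nat.DivMod using (m≡m%n+[m/n]*n; m%n<n)
  open import Data.Nat.ListAction using (sum)
  open import Data.Nat.ListAction.Properties using (sum-++)
  open import Data.Nat.Properties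
  open ≡

  private variable
    A B : Set

  -- Reduces a linear inequality, with slack s, to an identity for the ring solver.
  ≤-cert : ∀ {a b p q} s → p ≤ q → a + q + s ≡ b + p → a ≤ b
  ≤-cert {a} {b} {p} {q} s p≤q eq = +-cancelʳ-≤ q a b (begin
    a + q      ≤⟨ m≤m+n (a + q) s ⟩
    a + q + s  ≡⟨ eq ⟩
    b + p      ≤⟨ +-monoʳ-≤ b p≤q ⟩
    b + q      ∎)
    where open ≤-Reasoning

  -- Counting by sums over lists

  ⟦_⟧ : Bool → ℕ
  ⟦ b ⟧ = if b then 1 else 0

  ⟦⟧-≤ : ∀ b {k} → (T b → 1 ≤ k) → ⟦ b ⟧ ≤ k
  ⟦⟧-≤ true  h = h _
  ⟦⟧-≤ false h = z≤n

  ⟦⟧-true : ∀ b → T b → 1 ≤ ⟦ b ⟧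
  ⟦⟧-true true _ = ≤-refl

  ∑ : List A → (A → ℕ) → ℕ
  ∑ xs f = sum (List.map f xs)

  ∑-cong : ∀ (xs : List A) {f g : A → ℕ} → (∀ x → f x ≡ g x) → ∑ xs f ≡ ∑ xs g
  ∑-cong []       h = refl
  ∑-cong (x ∷ xs) h = cong₂ _+_ (h x) (∑-cong xs h)

  ∑-mono : ∀ (xs : List A) {f g : A → ℕ} → (∀ x → f x ≤ g x) → ∑ xs f ≤ ∑ xs g
  ∑-mono []       h = z≤n
  ∑-mono (x ∷ xs) h = +-mono-≤ (h x) (∑-mono xs h)

  ∑-+ : ∀ (xs : List A) (f g : A → ℕ) → ∑ xs (λ x → f x + g x) ≡ ∑ xs f + ∑ xs g
  ∑-+ []       f g = refl
  ∑-+ (x ∷ xs) f g rewrite ∑-+ xs f g = interchange (f x) (g x) (∑ xs f) (∑ xs g)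
    where
    interchange : ∀ a b c d → a + b + (c + d) ≡ a + c + (b + d)
    interchange = solve-∀

  ∑-*ˡ : ∀ (xs : List A) c (f : A → ℕ) → ∑ xs (λ x → c * f x) ≡ c * ∑ xs f
  ∑-*ˡ []       c f = sym (*-zeroʳ c)
  ∑-*ˡ (x ∷ xs) c f rewrite ∑-*ˡ xs c f = sym (*-distribˡ-+ c (f x) (∑ xs f))

  ∑-*ʳ : ∀ (xs : List A) c (f : A → ℕ) → ∑ xs (λ x → f x * c) ≡ ∑ xs f * c
  ∑-*ʳ []       c f = refl
  ∑-*ʳ (x ∷ xs) c f rewrite ∑-*ʳ xs c f = sym (*-distribʳ-+ c (f x) (∑ xs f))

  ∑-const : ∀ (xs : List A) c → ∑ xs (const c) ≡ length xs * c
  ∑-const []       c = refl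
  ∑-const (x ∷ xs) c = cong (c +_) (∑-const xs c)

  ∑-++ : ∀ (xs ys : List A) (f : A → ℕ) → ∑ (xs ++ ys) f ≡ ∑ xs f + ∑ ys f
  ∑-++ xs ys f = trans (cong sum (map-++ f xs ys)) (sum-++ (List.map f xs) (List.map f ys))

  ∑-map : ∀ (g : A → B) xs (f : B → ℕ) → ∑ (List.map g xs) f ≡ ∑ xs (f ∘ g)
  ∑-map g xs f = cong sum (sym (map-∘ xs))

  ∑-swap : ∀ (xs : List A) (ys : List B) (f : A → B → ℕ) →
    ∑ xs (λ x → ∑ ys (λ y → f x y)) ≡ ∑ ys (λ y → ∑ xs (λ x → f x y))
  ∑-swap []       ys f = sym (trans (∑-const ys 0) (*-zeroʳ (length ys)))
  ∑-swap (x ∷ xs) ys f = trans (cong (∑ ys (f x) +_) (∑-swap xs ys f))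
    (sym (∑-+ ys (f x) (λ y → ∑ xs (λ x → f x y))))

  ∑-All : ∀ {xs : List A} {f : A → ℕ} {c} → All (λ x → c ≤ f x) xs → length xs * c ≤ ∑ xs f
  ∑-All []       = z≤n
  ∑-All (h ∷ hs) = +-mono-≤ h (∑-All hs)

  length-filterᵇ : ∀ (p : A → Bool) xs → length (List.filterᵇ p xs) ≡ ∑ xs (⟦_⟧ ∘ p)
  length-filterᵇ p []       = refl
  length-filterᵇ p (x ∷ xs) with p x
  ... | true  = cong suc (length-filterᵇ p xs)
  ... | false = length-filterᵇ p xs

  ∑-allPoints : ∀ n (f : Point (suc n) → ℕ) → ∑ (allPoints (suc n)) f ≡
    ∑ (allPoints n) (f ∘ (neg ∷_)) + (∑ (allPoints n) (f ∘ (zer ∷_)) + ∑ (allPoints n) (f ∘ (pos ∷_)))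
  ∑-allPoints n f = begin
    ∑ (N ++ Z ++ P ++ []) f                ≡⟨ ∑-++ N _ f ⟩
    ∑ N f + ∑ (Z ++ P ++ []) f             ≡⟨ cong (∑ N f +_) (∑-++ Z _ f) ⟩
    ∑ N f + (∑ Z f + ∑ (P ++ []) f)        ≡⟨ cong (λ s → ∑ N f + (∑ Z f + s)) (trans (∑-++ P [] f) (+-identityʳ _)) ⟩
    ∑ N f + (∑ Z f + ∑ P f)                ≡⟨ cong₂ _+_ (∑-map _ ps f) (cong₂ _+_ (∑-map _ ps f) (∑-map _ ps f)) ⟩
    _ ∎
    where
    open ≡-Reasoning
    ps = allPoints n
    N = List.map (neg ∷_) ps
    Z = List.map (zer ∷_) ps
    P = List.map (pos ∷_) ps

  length-allPoints : ∀ n → length (allPoints n) ≡ 3 ^ n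
  length-allPoints zero    = refl
  length-allPoints (suc n) = begin
    length (allPoints (suc n))               ≡⟨ *-identityʳ _ ⟨
    length (allPoints (suc n)) * 1           ≡⟨ ∑-const (allPoints (suc n)) 1 ⟨
    ∑ (allPoints (suc n)) (const 1)          ≡⟨ ∑-allPoints n (const 1) ⟩
    c + (c + c)
      ≡⟨ cong (λ k → k + (k + k)) (trans (∑-const (allPoints n) 1) (trans (*-identityʳ _) (length-allPoints n))) ⟩
    3 ^ n + (3 ^ n + 3 ^ n)                  ≡⟨ cong (λ k → 3 ^ n + (3 ^ n + k)) (+-identityʳ (3 ^ n)) ⟨
    3 ^ suc n ∎
    where
    open ≡-Reasoning
    c = ∑ (allPoints n) (const 1)

  -- Additive functions on the cube

  Weight : Set
  Weight = Trit → ℕ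

  total : ∀ {n} → Vec Weight n → Point n → ℕ
  total []       x = 0
  total (w ∷ ws) x = w (head x) + total ws (tail x)

  -- The uniform value has mean 1 and variance e / 3.
  Centred : ℕ → Weight → Set
  Centred e w = (w neg + w zer + w pos ≡ 3) ×
    (w neg * w neg + w zer * w zer + w pos * w pos ≡ 3 + e)

  ∑-total : ∀ {n e} {ws : Vec Weight n} → VAll (Centred e) ws →
    ∑ (allPoints n) (total ws) ≡ n * 3 ^ n
  ∑-total []                             = refl
  ∑-total {suc n} {ws = w ∷ ws} (cw ∷ cs) = begin
    ∑ (allPoints (suc n)) (total (w ∷ ws))
      ≡⟨ ∑-allPoints n (total (w ∷ ws)) ⟩
    s neg + (s zer + s pos)
      ≡⟨ cong₂ _+_ (eq neg) (cong₂ _+_ (eq zer) (eq pos)) ⟩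
    (3 ^ n * w neg + n * 3 ^ n) + ((3 ^ n * w zer + n * 3 ^ n) + (3 ^ n * w pos + n * 3 ^ n))
      ≡⟨ rearrange (3 ^ n) n (w neg) (w zer) (w pos) ⟩
    3 ^ n * (w neg + w zer + w pos) + n * 3 ^ suc n
      ≡⟨ cong (λ k → 3 ^ n * k + n * 3 ^ suc n) (proj₁ cw) ⟩
    3 ^ n * 3 + n * 3 ^ suc n
      ≡⟨ cong (_+ n * 3 ^ suc n) (*-comm (3 ^ n) 3) ⟩
    suc n * 3 ^ suc n ∎
    where
    open ≡-Reasoning
    s : Trit → ℕ
    s t = ∑ (allPoints n) (λ x → w t + total ws x)
    eq : ∀ t → s t ≡ 3 ^ n * w t + n * 3 ^ n
    eq t = trans (∑-+ (allPoints n) (const (w t)) (total ws))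
      (cong₂ _+_ (trans (∑-const (allPoints n) (w t)) (cong (_* w t) (length-allPoints n))) (∑-total cs))
    rearrange : ∀ c n a b d → (c * a + n * c) + ((c * b + n * c) + (c * d + n * c)) ≡ c * (a + b + d) + n * (3 * c)
    rearrange = solve-∀

  -- The coordinates are independent with mean 1 and variance e/3, so the second moment of the total
  -- is n² + n·e/3; the factor 3 clears the denominator.
  ∑-total² : ∀ {n e} {ws : Vec Weight n} → VAll (Centred e) ws →
    3 * ∑ (allPoints n) (λ x → total ws x * total ws x) ≡ 3 ^ n * (3 * (n * n) + e * n)
  ∑-total² {e = e} [] = sym (trans (+-identityʳ _) (*-zeroʳ e))
  ∑-total² {suc n} {e} {w ∷ ws} (cw ∷ cs) = begin
    3 * ∑ (allPoints (suc n)) (λ x → total (w ∷ ws) x * total (w ∷ ws) x)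
      ≡⟨ cong (3 *_) (∑-allPoints n _) ⟩
    3 * (s neg + (s zer + s pos))
      ≡⟨ cong (3 *_) (cong₂ _+_ (eq neg) (cong₂ _+_ (eq zer) (eq pos))) ⟩
    3 * (r (w neg) + (r (w zer) + r (w pos)))
      ≡⟨ rearrange (3 ^ n) (n * 3 ^ n) M₂ (w neg) (w zer) (w pos) ⟩
    3 * (3 ^ n * (w neg * w neg + w zer * w zer + w pos * w pos) + 2 * (n * 3 ^ n) * (w neg + w zer + w pos)) + 3 * (3 * M₂)
      ≡⟨ cong (λ k → 3 * (3 ^ n * (w neg * w neg + w zer * w zer + w pos * w pos) + 2 * (n * 3 ^ n) * (w neg + w zer + w pos)) + 3 * k) (∑-total² cs) ⟩
    _ ≡⟨ cong₂ (λ k l → 3 * (3 ^ n * k + 2 * (n * 3 ^ n) * l) + 3 * (3 ^ n * (3 * (n * n) + e * n))) (proj₂ cw) (proj₁ cw) ⟩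
    3 * (3 ^ n * (3 + e) + 2 * (n * 3 ^ n) * 3) + 3 * (3 ^ n * (3 * (n * n) + e * n))
      ≡⟨ final (3 ^ n) n e ⟩
    3 ^ suc n * (3 * (suc n * suc n) + e * suc n) ∎
    where
    open ≡-Reasoning
    P = allPoints n
    F = total ws
    M₂ = ∑ P (λ x → F x * F x)
    r : ℕ → ℕ
    r a = 3 ^ n * (a * a) + (2 * a * (n * 3 ^ n) + M₂)
    s : Trit → ℕ
    s t = ∑ P (λ x → (w t + F x) * (w t + F x))
    square : ∀ a b → (a + b) * (a + b) ≡ a * a + (2 * a * b + b * b)
    square = solve-∀
    eq : ∀ t → s t ≡ r (w t)
    eq t = begin
      s t
        ≡⟨ ∑-cong P (λ x → square (w t) (F x)) ⟩
      ∑ P (λ x → w t * w t + (2 * w t * F x + F x * F x))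
        ≡⟨ ∑-+ P _ _ ⟩
      ∑ P (const (w t * w t)) + ∑ P (λ x → 2 * w t * F x + F x * F x)
        ≡⟨ cong₂ _+_ (trans (∑-const P _) (cong (_* (w t * w t)) (length-allPoints n))) (∑-+ P _ _) ⟩
      3 ^ n * (w t * w t) + (∑ P (λ x → 2 * w t * F x) + M₂)
        ≡⟨ cong (λ k → 3 ^ n * (w t * w t) + (k + M₂)) (trans (∑-*ˡ P (2 * w t) F) (cong (2 * w t *_) (∑-total cs))) ⟩
      r (w t) ∎
    rearrange : ∀ c p m a b d →
      3 * ((c * (a * a) + (2 * a * p + m)) + ((c * (b * b) + (2 * b * p + m)) + (c * (d * d) + (2 * d * p + m)))) ≡
      3 * (c * (a * a + b * b + d * d) + 2 * p * (a + b + d)) + 3 * (3 * m)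
    rearrange = solve-∀
    final : ∀ c n e → 3 * (c * (3 + e) + 2 * (n * c) * 3) + 3 * (c * (3 * (n * n) + e * n)) ≡ (3 * c) * (3 * (suc n * suc n) + e * suc n)
    final = solve-∀

  -- (F − n)² ≥ d², expanded so that no subtraction occurs.
  deviation : ∀ n d F → (n + d ≤ F) ⊎ (F + d ≤ n) → d * d + 2 * n * F ≤ F * F + n * n
  deviation n d F (inj₁ n+d≤F) with m≤n⇒∃[o]m+o≡n n+d≤F
  ... | k , refl = ≤-cert (k * (k + 2 * d)) z≤n (eq n d k)
    where
    eq : ∀ n d k → d * d + 2 * n * (n + d + k) + 0 + k * (k + 2 * d) ≡ (n + d + k) * (n + d + k) + n * n + 0
    eq = solve-∀
  deviation n d F (inj₂ F+d≤n) with m≤n⇒∃[o]m+o≡n F+d≤n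
  ... | k , refl = ≤-cert (k * (k + 2 * d)) z≤n (eq F d k)
    where
    eq : ∀ F d k → d * d + 2 * (F + d + k) * F + 0 + k * (k + 2 * d) ≡ F * F + (F + d + k) * (F + d + k) + 0
    eq = solve-∀

  2ab≤a²+b² : ∀ n F → 2 * n * F ≤ F * F + n * n
  2ab≤a²+b² n F with ≤-total n F
  ... | inj₁ n≤F = deviation n 0 F (inj₁ (subst (_≤ F) (sym (+-identityʳ n)) n≤F))
  ... | inj₂ F≤n = deviation n 0 F (inj₂ (subst (_≤ n) (sym (+-identityʳ F)) F≤n))

  -- Sum `deviation` over the points where `p` holds and its case d = 0 over the others. Once the
  -- two moments are inserted, the terms in n² cancel and only the variance is left.
  chebyshev : ∀ {n e} {ws : Vec Weight n} → VAll (Centred e) ws → ∀ d (p : Point n → Bool) →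
    (∀ x → T (p x) → (n + d ≤ total ws x) ⊎ (total ws x + d ≤ n)) →
    3 * (d * d) * ∑ (allPoints n) (⟦_⟧ ∘ p) ≤ e * n * 3 ^ n
  chebyshev {n} {e} {ws} cs d p far = ≤-cert 0 (*-monoʳ-≤ 3 summed) (begin
    3 * (d * d) * N + 3 * (M₂ + L * (n * n)) + 0
      ≡⟨ e₁ (d * d) N M₂ (L * (n * n)) ⟩
    3 * (d * d * N) + 3 * M₂ + 3 * (L * (n * n))
      ≡⟨ cong₂ (λ k l → 3 * (d * d * N) + k + 3 * (l * (n * n))) (∑-total² cs) (length-allPoints n) ⟩
    3 * (d * d * N) + 3 ^ n * (3 * (n * n) + e * n) + 3 * (3 ^ n * (n * n))
      ≡⟨ e₂ (d * d * N) (3 ^ n) n e ⟩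
    e * n * 3 ^ n + 3 * (d * d * N + 2 * n * (n * 3 ^ n))
      ≡⟨ cong (λ k → e * n * 3 ^ n + 3 * (d * d * N + 2 * n * k)) (∑-total cs) ⟨
    e * n * 3 ^ n + 3 * (d * d * N + 2 * n * ∑ P F) ∎)
    where
    open ≡-Reasoning
    P = allPoints n
    F = total ws
    N = ∑ P (⟦_⟧ ∘ p)
    M₂ = ∑ P (λ x → F x * F x)
    L = length P
    pointwise : ∀ x b → (T b → (n + d ≤ F x) ⊎ (F x + d ≤ n)) → d * d * ⟦ b ⟧ + 2 * n * F x ≤ F x * F x + n * n
    pointwise x true  h rewrite *-identityʳ (d * d) = deviation n d (F x) (h _)
    pointwise x false h rewrite *-zeroʳ (d * d) = 2ab≤a²+b² n (F x)
    summed : d * d * N + 2 * n * ∑ P F ≤ M₂ + L * (n * n)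
    summed = subst₂ _≤_
      (trans (∑-+ P _ _) (cong₂ _+_ (∑-*ˡ P (d * d) _) (∑-*ˡ P (2 * n) F)))
      (trans (∑-+ P _ _) (cong (M₂ +_) (∑-const P (n * n))))
      (∑-mono P λ x → pointwise x (p x) (far x))
    e₁ : ∀ q N M k → 3 * q * N + 3 * (M + k) + 0 ≡ 3 * (q * N) + 3 * M + 3 * k
    e₁ = solve-∀
    e₂ : ∀ D c n e → 3 * D + c * (3 * (n * n) + e * n) + 3 * (c * (n * n)) ≡ e * n * c + 3 * (D + 2 * n * (n * c))
    e₂ = solve-∀

  -- Sign vectors, heights and zero counts

  Signs : ℕ → Set
  Signs = Vec Bool

  sign : Bool → Trit
  sign true  = pos
  sign false = neg

  flip : ∀ {n} → Signs n → Signs n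
  flip = Vec.map not

  heightAt : Bool → Weight
  heightAt true  neg = 0
  heightAt true  zer = 1
  heightAt true  pos = 2
  heightAt false neg = 2
  heightAt false zer = 1
  heightAt false pos = 0

  zeroAt : Weight
  zeroAt zer = 1
  zeroAt _   = 0

  agreeAt : Bool → Weight
  agreeAt true  pos = 1
  agreeAt false neg = 1
  agreeAt _     _   = 0

  -- height v x = n + ⟨v,x⟩
  height agree : ∀ {n} → Signs n → Point n → ℕ
  height v = total (Vec.map heightAt v)
  agree  v = total (Vec.map agreeAt v)

  zeros : ∀ {n} → Point n → ℕ
  zeros {n} = total (Vec.replicate n zeroAt)

  height-flip : ∀ {n} (v : Signs n) x → height v x + height (flip v) x ≡ 2 * n
  height-flip []      []      = refl
  height-flip {suc n} (b ∷ v) (t ∷ x) = trans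
    (interchange (heightAt b t) (heightAt (not b) t) (height v x) (height (flip v) x))
    (trans (cong₂ _+_ (at b t) (height-flip v x)) (eq n))
    where
    interchange : ∀ a b c d → a + c + (b + d) ≡ a + b + (c + d)
    interchange = solve-∀
    eq : ∀ n → 2 + 2 * n ≡ 2 * suc n
    eq = solve-∀
    at : ∀ b t → heightAt b t + heightAt (not b) t ≡ 2
    at true  neg = refl
    at true  zer = refl
    at true  pos = refl
    at false neg = refl
    at false zer = refl
    at false pos = refl

  -- `agree` governs how many ways a point arises by painting, whereas painting controls height and
  -- zeros; this identity passes from one to the other.
  height-agree : ∀ {n} (v : Signs n) x → height v x ≡ 2 * agree v x + zeros x
  height-agree []      []      = refl
  height-agree (b ∷ v) (t ∷ x) = trans (cong₂ _+_ (at b t) (height-agree v x))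
    (eq (agreeAt b t) (zeroAt t) (agree v x) (zeros x))
    where
    at : ∀ b t → heightAt b t ≡ 2 * agreeAt b t + zeroAt t
    at true  neg = refl
    at true  zer = refl
    at true  pos = refl
    at false neg = refl
    at false zer = refl
    at false pos = refl
    eq : ∀ a b c d → 2 * a + b + (2 * c + d) ≡ 2 * (a + c) + (b + d)
    eq = solve-∀

  height-centred : ∀ {n} (v : Signs n) → VAll (Centred 2) (Vec.map heightAt v)
  height-centred []          = []
  height-centred (true ∷ v)  = (refl , refl) ∷ height-centred v
  height-centred (false ∷ v) = (refl , refl) ∷ height-centred v

  -- The number of zeros has mean n/3. Tripling gives each coordinate mean 1, as `Centred` requires,
  -- with squares adding up to 9 = 3 + 6.
  3zeroAt : Weight
  3zeroAt t = 3 * zeroAt t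

  3zeros-centred : ∀ n → VAll (Centred 6) (Vec.replicate n 3zeroAt)
  3zeros-centred zero    = []
  3zeros-centred (suc n) = (refl , refl) ∷ 3zeros-centred n

  total-3zeros : ∀ {n} (x : Point n) → total (Vec.replicate n 3zeroAt) x ≡ 3 * zeros x
  total-3zeros []      = refl
  total-3zeros (t ∷ x) = trans (cong (3 * zeroAt t +_) (total-3zeros x)) (sym (*-distribˡ-+ 3 (zeroAt t) (zeros x)))

  -- Filling zeros of a point

  masks : ∀ {n} → Point n → ℕ → List (Vec Bool n)
  masks []        zero    = [] ∷ []
  masks []        (suc a) = []
  masks (neg ∷ z) a       = List.map (false ∷_) (masks z a)
  masks (pos ∷ z) a       = List.map (false ∷_) (masks z a)
  masks (zer ∷ z) zero    = List.map (false ∷_) (masks z zero)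
  masks (zer ∷ z) (suc a) = List.map (true ∷_) (masks z a) ++ List.map (false ∷_) (masks z (suc a))

  paintAt : Bool → Bool → Trit → Trit
  paintAt b m t = if m then sign b else t

  paint : ∀ {n} → Signs n → Vec Bool n → Point n → Point n
  paint []      []      []      = []
  paint (b ∷ v) (m ∷ M) (t ∷ z) = paintAt b m t ∷ paint v M z

  data IsMask : ∀ {n} → ℕ → Point n → Vec Bool n → Set where
    []   : IsMask 0 [] []
    keep : ∀ {n a t} {z : Point n} {M} → IsMask a z M → IsMask a (t ∷ z) (false ∷ M)
    fill : ∀ {n a} {z : Point n} {M} → IsMask a z M → IsMask (suc a) (zer ∷ z) (true ∷ M)

  masks-sound : ∀ {n} (z : Point n) a → All (IsMask a z) (masks z a)
  masks-sound []        zero    = [] ∷ []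
  masks-sound []        (suc a) = []
  masks-sound (neg ∷ z) a       = All.map⁺ (All.map keep (masks-sound z a))
  masks-sound (pos ∷ z) a       = All.map⁺ (All.map keep (masks-sound z a))
  masks-sound (zer ∷ z) zero    = All.map⁺ (All.map keep (masks-sound z zero))
  masks-sound (zer ∷ z) (suc a) = All.++⁺
    (All.map⁺ (All.map fill (masks-sound z a)))
    (All.map⁺ (All.map keep (masks-sound z (suc a))))

  pascal : ∀ n k → suc n C suc k ≡ n C k + n C suc k
  pascal n k = sym (nCk+nC[k+1]≡[n+1]C[k+1] n k)

  length-masks : ∀ {n} (z : Point n) a → length (masks z a) ≡ zeros z C a
  length-masks []        zero    = refl
  length-masks []        (suc a) = sym (k>n⇒nCk≡0 {0} {suc a} (s≤s z≤n))
  length-masks (neg ∷ z) a       = trans (length-map _ (masks z a)) (length-masks z a)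
  length-masks (pos ∷ z) a       = trans (length-map _ (masks z a)) (length-masks z a)
  length-masks (zer ∷ z) zero    = trans (length-map _ (masks z zero)) (length-masks z zero)
  length-masks (zer ∷ z) (suc a) = begin
    length (List.map (true ∷_) (masks z a) ++ List.map (false ∷_) (masks z (suc a)))
      ≡⟨ length-++ (List.map (true ∷_) (masks z a)) ⟩
    _ ≡⟨ cong₂ _+_ (length-map _ (masks z a)) (length-map _ (masks z (suc a))) ⟩
    length (masks z a) + length (masks z (suc a))
      ≡⟨ cong₂ _+_ (length-masks z a) (length-masks z (suc a)) ⟩
    zeros z C a + zeros z C suc a
      ≡⟨ pascal (zeros z) a ⟨
    suc (zeros z) C suc a ∎
    where open ≡-Reasoning

  paint-zeros : ∀ {n a} {z : Point n} {M} (v : Signs n) → IsMask a z M → zeros (paint v M z) + a ≡ zeros z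
  paint-zeros []          []       = refl
  paint-zeros (b ∷ v)     (keep {t = t} i) = trans (+-assoc (zeroAt t) _ _) (cong (zeroAt t +_) (paint-zeros v i))
  paint-zeros (true ∷ v)  (fill i) = trans (+-suc _ _) (cong suc (paint-zeros v i))
  paint-zeros (false ∷ v) (fill i) = trans (+-suc _ _) (cong suc (paint-zeros v i))

  paint-height : ∀ {n a} {z : Point n} {M} (v : Signs n) → IsMask a z M → height v (paint v M z) ≡ height v z + a
  paint-height []          []       = refl
  paint-height (b ∷ v)     (keep {t = t} i) =
    trans (cong (heightAt b t +_) (paint-height v i)) (sym (+-assoc (heightAt b t) _ _))
  paint-height (true ∷ v)  (fill i) = trans (cong (2 +_) (paint-height v i)) (cong suc (sym (+-suc _ _)))
  paint-height (false ∷ v) (fill i) = trans (cong (2 +_) (paint-height v i)) (cong suc (sym (+-suc _ _)))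

  -- These are exactly the pairs of entries whose average is again an entry. Through this discrete
  -- relation convexity reaches the counting argument without real numbers.
  data Midpoint : Trit → Trit → Trit → Set where
    same : ∀ {t} → Midpoint t t t
    up   : Midpoint pos neg zer
    down : Midpoint neg pos zer

  paint-midpoint : ∀ {n a} {z : Point n} {M} (v : Signs n) → IsMask a z M → ∀ i →
    Midpoint (Vec.lookup (paint v M z) i) (Vec.lookup (paint (flip v) M z) i) (Vec.lookup z i)
  paint-midpoint (b ∷ v)     (keep i) zero    = same
  paint-midpoint (true ∷ v)  (fill i) zero    = up
  paint-midpoint (false ∷ v) (fill i) zero    = down
  paint-midpoint (b ∷ v)     (keep i) (suc j) = paint-midpoint v i j
  paint-midpoint (b ∷ v)     (fill i) (suc j) = paint-midpoint v i j

  -- Pairs (z , M) correspond to pairs (x , M) in which x agrees with v on M.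
  ∑-paint : ∀ {n} (v : Signs n) a (f : Point n → ℕ) →
    ∑ (allPoints n) (λ z → ∑ (masks z a) (λ M → f (paint v M z))) ≡
    ∑ (allPoints n) (λ x → f x * (agree v x C a))
  ∑-paint [] zero    f = cong (_+ 0) (trans (+-identityʳ _) (sym (*-identityʳ _)))
  ∑-paint [] (suc a) f = cong (_+ 0) (sym (trans (cong (f [] *_) (k>n⇒nCk≡0 {0} {suc a} (s≤s z≤n))) (*-zeroʳ (f []))))
  ∑-paint {suc n} (b ∷ v) a f = begin
    ∑ (allPoints (suc n)) (λ z → ∑ (masks z a) (λ M → f (paint (b ∷ v) M z)))
      ≡⟨ ∑-allPoints n _ ⟩
    L b neg a + (L b zer a + L b pos a)
      ≡⟨ cong₂ (λ k l → k + (L b zer a + l)) (kept b neg a) (kept b pos a) ⟩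
    R neg a + (L b zer a + R pos a)
      ≡⟨ fill-or-keep b a ⟩
    Q b neg a + (Q b zer a + Q b pos a)
      ≡⟨ ∑-allPoints n _ ⟨
    ∑ (allPoints (suc n)) (λ x → f x * (agree (b ∷ v) x C a)) ∎
    where
    open ≡-Reasoning
    P = allPoints n
    F : Bool → Trit → Point n → Vec Bool (suc n) → ℕ
    F b t z M = f (paint (b ∷ v) M (t ∷ z))
    L Q : Bool → Trit → ℕ → ℕ
    L b t a = ∑ P (λ z → ∑ (masks (t ∷ z) a) (F b t z))
    Q b t a = ∑ P (λ x → f (t ∷ x) * (agree (b ∷ v) (t ∷ x) C a))
    R : Trit → ℕ → ℕ
    R t a = ∑ P (λ x → f (t ∷ x) * (agree v x C a))
    kept : ∀ b t a → ∑ P (λ z → ∑ (List.map (false ∷_) (masks z a)) (F b t z)) ≡ R t a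
    kept b t a = trans (∑-cong P λ z → ∑-map (false ∷_) (masks z a) (F b t z)) (∑-paint v a (f ∘ (t ∷_)))
    filled : ∀ b a → L b zer (suc a) ≡ R (sign b) a + R zer (suc a)
    filled b a = begin
      L b zer (suc a)
        ≡⟨ ∑-cong P (λ z → ∑-++ (List.map (true ∷_) (masks z a)) _ (F b zer z)) ⟩
      ∑ P (λ z → ∑ (List.map (true ∷_) (masks z a)) (F b zer z) + ∑ (List.map (false ∷_) (masks z (suc a))) (F b zer z))
        ≡⟨ ∑-+ P _ _ ⟩
      _ ≡⟨ cong₂ _+_
             (trans (∑-cong P λ z → ∑-map (true ∷_) (masks z a) (F b zer z)) (∑-paint v a (f ∘ (sign b ∷_))))
             (kept b zer (suc a)) ⟩
      R (sign b) a + R zer (suc a) ∎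
    split : ∀ t a → ∑ P (λ x → f (t ∷ x) * (suc (agree v x) C suc a)) ≡ R t a + R t (suc a)
    split t a = trans
      (∑-cong P λ x → trans (cong (f (t ∷ x) *_) (pascal (agree v x) a)) (*-distribˡ-+ (f (t ∷ x)) _ _))
      (∑-+ P _ _)
    -- A point with first entry `sign b` arises either by keeping that entry or by filling a zero;
    -- the two sources are the two terms of Pascal's rule.
    fill-or-keep : ∀ b a → R neg a + (L b zer a + R pos a) ≡ Q b neg a + (Q b zer a + Q b pos a)
    fill-or-keep true  zero    = cong (λ k → R neg 0 + (k + R pos 0)) (kept true zer 0)
    fill-or-keep false zero    = cong (λ k → R neg 0 + (k + R pos 0)) (kept false zer 0)
    fill-or-keep true  (suc a) = cong (R neg (suc a) +_) (begin
      L true zer (suc a) + R pos (suc a)                ≡⟨ cong (_+ R pos (suc a)) (filled true a) ⟩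
      R pos a + R zer (suc a) + R pos (suc a)           ≡⟨ rotate (R pos a) _ _ ⟩
      R zer (suc a) + (R pos a + R pos (suc a))         ≡⟨ cong (R zer (suc a) +_) (split pos a) ⟨
      Q true zer (suc a) + Q true pos (suc a)           ∎)
      where
      rotate : ∀ p z q → p + z + q ≡ z + (p + q)
      rotate = solve-∀
    fill-or-keep false (suc a) = begin
      R neg (suc a) + (L false zer (suc a) + R pos (suc a))
        ≡⟨ cong (λ k → R neg (suc a) + (k + R pos (suc a))) (filled false a) ⟩
      R neg (suc a) + (R neg a + R zer (suc a) + R pos (suc a))
        ≡⟨ rotate (R neg (suc a)) (R neg a) _ _ ⟩
      R neg a + R neg (suc a) + (R zer (suc a) + R pos (suc a))
        ≡⟨ cong (_+ (R zer (suc a) + R pos (suc a))) (split neg a) ⟨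
      Q false neg (suc a) + (Q false zer (suc a) + Q false pos (suc a)) ∎
      where
      rotate : ∀ p q z r → p + (q + z + r) ≡ q + p + (z + r)
      rotate = solve-∀

  -- Binomial coefficients

  -- The subtraction-free form of (k+1)·C(n,k+1) = (n-k)·C(n,k), correct also for k > n.
  C-absorb : ∀ n k → suc k * (n C suc k) + k * (n C k) ≡ n * (n C k)
  C-absorb zero    zero    = refl
  C-absorb zero    (suc k)
    rewrite k>n⇒nCk≡0 {0} {suc (suc k)} (s≤s z≤n) | k>n⇒nCk≡0 {0} {suc k} (s≤s z≤n) | *-zeroʳ k = refl
  C-absorb (suc n) zero    rewrite nC1≡n (suc n) = eq n
    where
    eq : ∀ n → suc n + 0 + 0 ≡ suc n * 1
    eq = solve-∀
  C-absorb (suc n) (suc k) rewrite pascal n (suc k) | pascal n k = trans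
    (regroup k (n C k) (n C suc k) (n C suc (suc k)))
    (trans (cong₂ (λ p q → p + (q + ((n C k) + (n C suc k)))) (C-absorb n (suc k)) (C-absorb n k))
      (collect n (n C k) (n C suc k)))
    where
    regroup : ∀ k a b c → suc (suc k) * (b + c) + suc k * (a + b) ≡
      (suc (suc k) * c + suc k * b) + ((suc k * b + k * a) + (a + b))
    regroup = solve-∀
    collect : ∀ n a b → n * b + (n * a + (a + b)) ≡ suc n * (a + b)
    collect = solve-∀

  -- C(q,k) is a product of factors q − i over i < k, and the hypothesis gives
  -- (q + d − i) / (q − i) ≤ (s + 1) / s for each of them.
  C-ratio : ∀ {q d s} k → k + s * d ≤ q → ((q + d) C k) * s ^ k ≤ (q C k) * suc s ^ k
  C-ratio zero _ = ≤-refl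
  C-ratio {q} {d} {s} (suc k) h = *-cancelˡ-≤ (suc k) (begin
    suc k * (((q + d) C suc k) * (s * s ^ k))
      ≡⟨ e₁ (suc k) _ s _ ⟩
    s * (suc k * ((q + d) C suc k)) * s ^ k
      ≤⟨ *-monoˡ-≤ (s ^ k) factor ⟩
    suc s * u * ((q + d) C k) * s ^ k
      ≡⟨ *-assoc (suc s * u) _ _ ⟩
    suc s * u * (((q + d) C k) * s ^ k)
      ≤⟨ *-monoʳ-≤ (suc s * u) (C-ratio k k+sd≤q) ⟩
    suc s * u * ((q C k) * suc s ^ k)
      ≡⟨ e₂ (suc s) u (q C k) (suc s ^ k) ⟩
    u * (q C k) * (suc s * suc s ^ k)
      ≡⟨ cong (_* (suc s * suc s ^ k)) uq ⟩
    suc k * (q C suc k) * (suc s * suc s ^ k)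
      ≡⟨ *-assoc (suc k) (q C suc k) (suc s * suc s ^ k) ⟩
    suc k * ((q C suc k) * (suc s * suc s ^ k)) ∎)
    where
    open ≤-Reasoning
    u = q ∸ k
    k+sd≤q : k + s * d ≤ q
    k+sd≤q = ≤-trans (n≤1+n _) h
    k+u : k + u ≡ q
    k+u = m+[n∸m]≡n (≤-trans (m≤m+n k (s * d)) k+sd≤q)
    uq : u * (q C k) ≡ suc k * (q C suc k)
    uq = +-cancelʳ-≡ (k * (q C k)) _ _ (trans (trans (sym (*-distribʳ-+ (q C k) u k))
      (cong (_* (q C k)) (trans (+-comm u k) k+u))) (sym (C-absorb q k)))
    uqd : (u + d) * ((q + d) C k) ≡ suc k * ((q + d) C suc k)
    uqd = +-cancelʳ-≡ (k * ((q + d) C k)) _ _ (trans (trans (sym (*-distribʳ-+ ((q + d) C k) (u + d) k))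
      (cong (_* ((q + d) C k)) (trans (+-comm (u + d) k) (trans (sym (+-assoc k u d)) (cong (_+ d) k+u))))) (sym (C-absorb (q + d) k)))
    sd≤u : s * d ≤ u
    sd≤u = +-cancelˡ-≤ k _ _ (≤-trans k+sd≤q (≤-reflexive (sym k+u)))
    e₀ : ∀ s u d → s * (u + d) ≡ s * u + s * d
    e₀ = solve-∀
    factor : s * (suc k * ((q + d) C suc k)) ≤ suc s * u * ((q + d) C k)
    factor = begin
      s * (suc k * ((q + d) C suc k)) ≡⟨ cong (s *_) uqd ⟨
      s * ((u + d) * ((q + d) C k))   ≡⟨ *-assoc s (u + d) _ ⟨
      s * (u + d) * ((q + d) C k)
        ≤⟨ *-monoˡ-≤ _ (≤-trans (≤-reflexive (e₀ s u d)) (≤-trans (+-monoʳ-≤ (s * u) sd≤u) (≤-reflexive (+-comm (s * u) u)))) ⟩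
      suc s * u * ((q + d) C k) ∎
    e₁ : ∀ k a s b → k * (a * (s * b)) ≡ s * (k * a) * b
    e₁ = solve-∀
    e₂ : ∀ s u a b → s * u * (a * b) ≡ u * a * (s * b)
    e₂ = solve-∀

  -- A discrete mean value estimate: the increment of the power is at most the derivative at the
  -- right endpoint.
  suc-^-≤ : ∀ s j → suc s ^ suc j ≤ s ^ suc j + suc j * suc s ^ j
  suc-^-≤ s zero    = ≤-reflexive (eq s)
    where
    eq : ∀ s → suc s * 1 ≡ s * 1 + (1 + 0)
    eq = solve-∀
  suc-^-≤ s (suc j) = begin
    suc s * suc s ^ suc j                                             ≡⟨ +-comm (suc s ^ suc j) (s * suc s ^ suc j) ⟩
    s * suc s ^ suc j + suc s ^ suc j                                 ≤⟨ +-monoˡ-≤ _ (*-monoʳ-≤ s (suc-^-≤ s j)) ⟩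
    s * (s ^ suc j + suc j * suc s ^ j) + suc s ^ suc j
      ≤⟨ ≤-cert (suc j * suc s ^ j) z≤n (eq s (suc j) (s ^ suc j) (suc s ^ j)) ⟩
    s ^ suc (suc j) + suc (suc j) * suc s ^ suc j                     ∎
    where
    open ≤-Reasoning
    eq : ∀ s j a b → s * (a + j * b) + suc s * b + 0 + j * b ≡ s * a + suc j * (suc s * b) + 0
    eq = solve-∀

  -- Bernoulli: (1 + 1/2u)^u ≤ 2.
  bernoulli : ∀ u → suc (2 * u) ^ u ≤ 2 * (2 * u) ^ u
  bernoulli zero    = s≤s z≤n
  -- Here s = 2(j+1), so twice the error term is s(s+1)^j. It falls short of (s+1)^(j+1) by (s+1)^j,
  -- which is the slack.
  bernoulli (suc j) = ≤-cert (suc s ^ j) (*-monoʳ-≤ 2 (suc-^-≤ s j)) (eq j (suc s ^ j) (s ^ suc j))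
    where
    s = 2 * suc j
    eq : ∀ j b a → suc (2 * suc j) * b + 2 * (a + suc j * b) + b ≡ 2 * a + 2 * (suc (2 * suc j) * b)
    eq = solve-∀

  C-monoˡ : ∀ k {p q} → p ≤ q → p C k ≤ q C k
  C-monoˡ zero    _ = ≤-refl
  C-monoˡ (suc k) {zero} _ rewrite k>n⇒nCk≡0 {0} {suc k} (s≤s z≤n) = z≤n
  C-monoˡ (suc k) {suc p} {suc q} (s≤s p≤q) rewrite pascal p k | pascal q k =
    +-mono-≤ (C-monoˡ k p≤q) (C-monoˡ (suc k) p≤q)

  C-pos : ∀ {q k} → k ≤ q → 1 ≤ q C k
  C-pos {q} {k} k≤q = ≤-trans (≤-reflexive (sym (nCn≡1 k))) (C-monoˡ k k≤q)

  *-^ : ∀ x y k → (x * y) ^ k ≡ x ^ k * y ^ k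
  *-^ x y zero    = refl
  *-^ x y (suc k) = trans (cong (x * y *_) (*-^ x y k)) (interchange x y (x ^ k) (y ^ k))
    where
    interchange : ∀ a b c d → a * b * (c * d) ≡ a * c * (b * d)
    interchange = solve-∀

  bernoulli-^ : ∀ u k → suc (2 * u) ^ (u * k) ≤ 2 ^ k * (2 * u) ^ (u * k)
  bernoulli-^ u k = begin
    suc (2 * u) ^ (u * k)         ≡⟨ ^-*-assoc (suc (2 * u)) u k ⟨
    (suc (2 * u) ^ u) ^ k         ≤⟨ ^-monoˡ-≤ k (bernoulli u) ⟩
    (2 * (2 * u) ^ u) ^ k         ≡⟨ *-^ 2 ((2 * u) ^ u) k ⟩
    2 ^ k * ((2 * u) ^ u) ^ k     ≡⟨ cong (2 ^ k *_) (^-*-assoc (2 * u) u k) ⟩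
    2 ^ k * (2 * u) ^ (u * k)     ∎
    where
    open ≤-Reasoning

  -- Charging violated midpoints

  violation : ∀ {s t s₁ t₁ s₂ t₂} → ¬ T s → T s₁ → T s₂ → (T t₁ → T t₂ → T t) →
    1 ≤ ⟦ s xor t ⟧ + (⟦ s₁ xor t₁ ⟧ + ⟦ s₂ xor t₂ ⟧)
  violation {true}                                       ¬s _ _ _ = contradiction _ ¬s
  violation {false} {_}     {true} {false}               _  _ _ _ = ≤-trans (s≤s z≤n) (m≤n+m _ _)
  violation {false} {true}  {true} {true}                _  _ _ _ = s≤s z≤n
  violation {false} {false} {true} {true} {true} {false} _  _ _ _ = s≤s z≤n
  violation {false} {false} {true} {true} {true} {true}  _  _ _ h = contradiction (h _ _) λ ()

  -- The exceptional fractions add up to 4/75 + 12/27 = 112/225, which is below 1/2.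
  majority : ∀ c z s u → c ≤ z + (s + u) → 75 * s ≤ 4 * c → 27 * u ≤ 12 * c → c ≤ 2 * z
  majority c z s u cover s≤ u≤ = *-cancelˡ-≤ 339 (≤-cert (3 * z)
    (+-mono-≤ (*-monoʳ-≤ 675 cover) (+-mono-≤ (*-monoʳ-≤ 9 s≤) (*-monoʳ-≤ 25 u≤))) (eq c z s u))
    where
    eq : ∀ c z s u → 339 * c + (675 * (z + (s + u)) + (9 * (4 * c) + 25 * (12 * c))) + 3 * z ≡
      339 * (2 * z) + (675 * c + (9 * (75 * s) + 25 * (27 * u)))
    eq = solve-∀

  -- Each core point z has at least C(q,a) masks, and each mask gives a triple with a positive value
  -- of `f`. Conversely, a point is charged at most C(R,a) times in each of its three roles: as z by
  -- its number of masks, and as either painted point because, by `∑-paint`, it arises in C(agree,a)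
  -- ways.
  double-count : ∀ {n} (v w : Signs n) (core : Point n → Bool) (f : Point n → ℕ) {a q R} →
    (∀ z → T (core z) → q ≤ zeros z × zeros z ≤ R) →
    (∀ z {M} → T (core z) → IsMask a z M →
      (agree v (paint v M z) ≤ R × agree w (paint w M z) ≤ R) × 1 ≤ f z + (f (paint v M z) + f (paint w M z))) →
    (q C a) * ∑ (allPoints n) (⟦_⟧ ∘ core) ≤ (R C a) * (3 * ∑ (allPoints n) f)
  double-count {n} v w core f {a} {q} {R} zeros-bounds masked = begin
    (q C a) * ∑ P (⟦_⟧ ∘ core)
      ≡⟨ ∑-*ˡ P (q C a) _ ⟨
    ∑ P (λ z → (q C a) * ⟦ core z ⟧)
      ≤⟨ ∑-mono P (λ z → charge z (core z) (zeros-bounds z) (masked z)) ⟩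
    ∑ P (λ z → (R C a) * f z + (painted v z + painted w z))
      ≡⟨ trans (∑-+ P _ _) (cong₂ _+_ (∑-*ˡ P (R C a) f) (∑-+ P (painted v) (painted w))) ⟩
    (R C a) * Δ + (∑ P (painted v) + ∑ P (painted w))
      ≤⟨ +-monoʳ-≤ ((R C a) * Δ) (+-mono-≤ (∑-painted v) (∑-painted w)) ⟩
    (R C a) * Δ + ((R C a) * Δ + (R C a) * Δ)
      ≡⟨ triple (R C a) Δ ⟩
    (R C a) * (3 * Δ) ∎
    where
    open ≤-Reasoning
    P = allPoints n
    Δ = ∑ P f

    -- A point with more than R agreements could be charged too often. No triple from the core
    -- contains such a point, so `f` may be cut off there.
    restricted : Signs n → Point n → ℕ
    restricted u x = if ⌊ agree u x ≤? R ⌋ then f x else 0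

    painted : Signs n → Point n → ℕ
    painted u z = ∑ (masks z a) (λ M → restricted u (paint u M z))

    restricted-inside : ∀ u x → agree u x ≤ R → restricted u x ≡ f x
    restricted-inside u x le with agree u x ≤? R
    ... | yes _ = refl
    ... | no ¬p = contradiction le ¬p

    restricted-≤ : ∀ u x → restricted u x * (agree u x C a) ≤ (R C a) * f x
    restricted-≤ u x with agree u x ≤? R
    ... | yes p = ≤-trans (*-monoʳ-≤ (f x) (C-monoˡ a p)) (≤-reflexive (*-comm (f x) (R C a)))
    ... | no _  = z≤n

    ∑-painted : ∀ u → ∑ P (painted u) ≤ (R C a) * Δ
    ∑-painted u = begin
      ∑ P (painted u)                                   ≡⟨ ∑-paint u a (restricted u) ⟩
      ∑ P (λ x → restricted u x * (agree u x C a))      ≤⟨ ∑-mono P (restricted-≤ u) ⟩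
      ∑ P (λ x → (R C a) * f x)                         ≡⟨ ∑-*ˡ P (R C a) f ⟩
      (R C a) * Δ                                       ∎

    cost : Point n → Vec Bool n → ℕ
    cost z M = f z + (restricted v (paint v M z) + restricted w (paint w M z))

    charge : ∀ z b → (T b → q ≤ zeros z × zeros z ≤ R) →
      (∀ {M} → T b → IsMask a z M →
        (agree v (paint v M z) ≤ R × agree w (paint w M z) ≤ R) × 1 ≤ f z + (f (paint v M z) + f (paint w M z))) →
      (q C a) * ⟦ b ⟧ ≤ (R C a) * f z + (painted v z + painted w z)
    charge z false _ _ rewrite *-zeroʳ (q C a) = z≤n
    charge z true zb mk = begin
      (q C a) * 1
        ≤⟨ *-monoˡ-≤ 1 (C-monoˡ a (proj₁ (zb _))) ⟩
      (zeros z C a) * 1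
        ≡⟨ cong (_* 1) (length-masks z a) ⟨
      length (masks z a) * 1
        ≤⟨ ∑-All (All.map (λ {M} → cost-pos M) (masks-sound z a)) ⟩
      ∑ (masks z a) (cost z)
        ≡⟨ trans (∑-+ (masks z a) _ _) (cong₂ _+_ (∑-const (masks z a) (f z)) (∑-+ (masks z a) _ _)) ⟩
      length (masks z a) * f z + (painted v z + painted w z)
        ≡⟨ cong (λ k → k * f z + (painted v z + painted w z)) (length-masks z a) ⟩
      (zeros z C a) * f z + (painted v z + painted w z)
        ≤⟨ +-monoˡ-≤ _ (*-monoˡ-≤ (f z) (C-monoˡ a (proj₂ (zb _)))) ⟩
      (R C a) * f z + (painted v z + painted w z) ∎
      where
      cost-pos : ∀ M → IsMask a z M → 1 ≤ cost z M
      cost-pos M mask with mk _ mask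
      ... | (rv , rw) , pos≤ = ≤-trans pos≤ (≤-reflexive (cong (f z +_)
        (cong₂ _+_ (sym (restricted-inside v _ rv)) (sym (restricted-inside w _ rw)))))

    triple : ∀ c d → c * d + (c * d + c * d) ≡ c * (3 * d)
    triple = solve-∀

  -- With s = 2u, `C-ratio` costs the factor (1 + 1/2u)^(uk), which Bernoulli bounds by 2^k. The
  -- loss is thus independent of u, although the number of chosen elements grows with u.
  C-shift-≤ : ∀ u k q d → .{{NonZero u}} → u * k + 2 * u * d ≤ q → ((q + d) C (u * k)) ≤ 2 ^ k * (q C (u * k))
  C-shift-≤ u k q d h = *-cancelʳ-≤ _ _ (s ^ a) (begin
    ((q + d) C a) * s ^ a           ≤⟨ C-ratio a h ⟩
    (q C a) * suc s ^ a             ≤⟨ *-monoʳ-≤ (q C a) (bernoulli-^ u k) ⟩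
    (q C a) * (2 ^ k * s ^ a)       ≡⟨ eq (q C a) (2 ^ k) (s ^ a) ⟩
    2 ^ k * (q C a) * s ^ a         ∎)
    where
    open ≤-Reasoning
    s = 2 * u
    a = u * k
    instance
      s≢0 : NonZero s
      s≢0 = m*n≢0 2 u
      sᵃ≢0 : NonZero (s ^ a)
      sᵃ≢0 = m^n≢0 s a
    eq : ∀ c k t → c * (k * t) ≡ k * c * t
    eq = solve-∀

  -- With m ≈ √n and lo ≈ n/3 − 11m, the truncated anti-slab of v omits the points with fewer
  -- than lo zeros, contains those with more than lo + 12m, and in between is |⟨v,x⟩| ≥ 5m.
  -- Core is a set of points inside the slab that have room for 10m new nonzero entries.
  module Antislab (n m lo : ℕ) where

    Tall Mem Core : Signs n → Point n → Set
    Tall v x = n + 5 * m ≤ height v x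
    Mem v x  = lo ≤ zeros x × (lo + 12 * m < zeros x ⊎ Tall v x ⊎ Tall (flip v) x)
    Core v z = (lo + 10 * m ≤ zeros z × zeros z ≤ lo + 12 * m) × (¬ Tall v z × ¬ Tall (flip v) z)

    tall? : ∀ v x → Dec (Tall v x)
    tall? v x = n + 5 * m ≤? height v x

    mem? : ∀ v x → Dec (Mem v x)
    mem? v x = lo ≤? zeros x ×-dec (lo + 12 * m <? zeros x ⊎-dec tall? v x ⊎-dec tall? (flip v) x)

    antislab : Signs n → CubeSet n
    antislab v x = ⌊ mem? v x ⌋

    MidpointClosed : CubeSet n → Set
    MidpointClosed S = ∀ x y z → (∀ i → Midpoint (Vec.lookup x i) (Vec.lookup y i) (Vec.lookup z i)) →
      x ∈ S → y ∈ S → z ∈ S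

  -- The multiple of 100 lets 10m = μ·1000 enter `C-shift-≤` with u = μ and a constant k, and `lo≥`
  -- is its hypothesis for a shift by 15m. `lower` and `upper` place lo + 11m, the middle of the
  -- core layers, at n/3 up to rounding.
  record Scale (n m lo : ℕ) : Set where
    field
      {μ}     : ℕ
      {{μ≢0}} : NonZero μ
      m≡100μ  : m ≡ 100 * μ
      n≤2m²   : n ≤ 2 * (m * m)
      lower   : 3 * (lo + 11 * m) ≤ n
      upper   : n ≤ 3 * (lo + 11 * m) + 2
      lo≥     : 2 * μ * (15 * m) ≤ lo

  -- Distance of the anti-slab from convex sets

  module Farness {n m lo} (sc : Scale n m lo) (v : Signs n) where
    open Scale sc
    open Antislab n m lo

    1≤m : 1 ≤ m
    1≤m = subst (1 ≤_) (sym m≡100μ) (≤-trans (>-nonZero⁻¹ μ) (m≤n*m μ 100))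

    instance
      m≢0 : NonZero m
      m≢0 = >-nonZero 1≤m

    private
      P = allPoints n

    core? : ∀ z → Dec (Core v z)
    core? z = (lo + 10 * m ≤? zeros z ×-dec zeros z ≤? lo + 12 * m) ×-dec (¬? (tall? v z) ×-dec ¬? (tall? (flip v) z))
      where open import Relation.Nullary.Decidable using (¬?)

    Steep Unbalanced : Point n → Set
    Steep z      = Tall v z ⊎ Tall (flip v) z
    Unbalanced z = n + 3 * m ≤ 3 * zeros z ⊎ 3 * zeros z + 3 * m ≤ n

    steep? : ∀ z → Dec (Steep z)
    steep? z = tall? v z ⊎-dec tall? (flip v) z

    unbalanced? : ∀ z → Dec (Unbalanced z)
    unbalanced? z = n + 3 * m ≤? 3 * zeros z ⊎-dec 3 * zeros z + 3 * m ≤? n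

    #core #steep #unbalanced : ℕ
    #core       = ∑ P (λ z → ⟦ ⌊ core? z ⌋ ⟧)
    #steep      = ∑ P (λ z → ⟦ ⌊ steep? z ⌋ ⟧)
    #unbalanced = ∑ P (λ z → ⟦ ⌊ unbalanced? z ⌋ ⟧)

    balanced-core : ∀ z → ¬ Unbalanced z → ¬ Steep z → Core v z
    balanced-core z bal flat = (low , high) , (flat ∘ inj₁ , flat ∘ inj₂)
      where
      e₁ : ∀ l m n q → 3 * (l + 10 * m) + (n + (3 * q + 3 * m)) + 1 ≡ 3 * q + (3 * (l + 11 * m) + suc n)
      e₁ = solve-∀
      e₂ : ∀ l m n q → 3 * q + (n + 3 * m + (3 * (l + 11 * m) + 2)) + 1 ≡ 3 * (l + 12 * m) + 2 + (suc (3 * q) + n)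
      e₂ = solve-∀
      low : lo + 10 * m ≤ zeros z
      low = *-cancelˡ-≤ 3 (≤-cert 1 (+-mono-≤ lower (≰⇒> (bal ∘ inj₂))) (e₁ lo m n (zeros z)))
      high : zeros z ≤ lo + 12 * m
      high = ≤-pred (*-cancelˡ-< 3 _ _ (begin-strict
        3 * zeros z                  ≤⟨ ≤-cert 1 (+-mono-≤ (≰⇒> (bal ∘ inj₁)) upper) (e₂ lo m n (zeros z)) ⟩
        3 * (lo + 12 * m) + 2        <⟨ +-monoʳ-< (3 * (lo + 12 * m)) (s≤s (s≤s (s≤s z≤n))) ⟩
        3 * (lo + 12 * m) + 3        ≡⟨ +-comm (3 * (lo + 12 * m)) 3 ⟩
        3 + 3 * (lo + 12 * m)        ≡⟨ *-suc 3 (lo + 12 * m) ⟨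
        3 * suc (lo + 12 * m)        ∎))
        where open ≤-Reasoning

    tall-flip : ∀ z → Tall (flip v) z → height v z + 5 * m ≤ n
    tall-flip z t = ≤-cert 0 t (begin
      height v z + 5 * m + height (flip v) z + 0       ≡⟨ e₁ (height v z) _ _ ⟩
      height v z + height (flip v) z + 5 * m           ≡⟨ cong (_+ 5 * m) (height-flip v z) ⟩
      2 * n + 5 * m                                    ≡⟨ e₂ n (5 * m) ⟩
      n + (n + 5 * m)                                  ∎)
      where
      open ≡-Reasoning
      e₁ : ∀ a b c → a + b + c + 0 ≡ a + c + b
      e₁ = solve-∀
      e₂ : ∀ n b → 2 * n + b ≡ n + (n + b)
      e₂ = solve-∀

    steep-bound : 75 * #steep ≤ 4 * 3 ^ n
    steep-bound = *-cancelˡ-≤ (m * m) (begin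
      m * m * (75 * #steep)                    ≡⟨ e₁ m #steep ⟩
      3 * (5 * m * (5 * m)) * #steep           ≤⟨ chebyshev (height-centred v) (5 * m) (λ z → ⌊ steep? z ⌋) deviates ⟩
      2 * n * 3 ^ n                            ≤⟨ *-monoˡ-≤ (3 ^ n) (*-monoʳ-≤ 2 n≤2m²) ⟩
      2 * (2 * (m * m)) * 3 ^ n                ≡⟨ e₂ (m * m) (3 ^ n) ⟩
      m * m * (4 * 3 ^ n)                      ∎)
      where
      open ≤-Reasoning
      instance
        m*m≢0 : NonZero (m * m)
        m*m≢0 = m*n≢0 m m
      deviates : ∀ z → T ⌊ steep? z ⌋ → n + 5 * m ≤ height v z ⊎ height v z + 5 * m ≤ n
      deviates z t = Sum.map₂ (tall-flip z) (toWitness {a? = steep? z} t)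
      e₁ : ∀ m N → m * m * (75 * N) ≡ 3 * (5 * m * (5 * m)) * N
      e₁ = solve-∀
      e₂ : ∀ k c → 2 * (2 * k) * c ≡ k * (4 * c)
      e₂ = solve-∀

    unbalanced-bound : 27 * #unbalanced ≤ 12 * 3 ^ n
    unbalanced-bound = *-cancelˡ-≤ (m * m) (begin
      m * m * (27 * #unbalanced)               ≡⟨ e₁ m #unbalanced ⟩
      3 * (3 * m * (3 * m)) * #unbalanced
        ≤⟨ chebyshev (3zeros-centred n) (3 * m) (λ z → ⌊ unbalanced? z ⌋) deviates ⟩
      6 * n * 3 ^ n                            ≤⟨ *-monoˡ-≤ (3 ^ n) (*-monoʳ-≤ 6 n≤2m²) ⟩
      6 * (2 * (m * m)) * 3 ^ n                ≡⟨ e₂ (m * m) (3 ^ n) ⟩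
      m * m * (12 * 3 ^ n)                     ∎)
      where
      open ≤-Reasoning
      instance
        m*m≢0 : NonZero (m * m)
        m*m≢0 = m*n≢0 m m
      deviates : ∀ z → T ⌊ unbalanced? z ⌋ →
        n + 3 * m ≤ total (Vec.replicate n 3zeroAt) z ⊎ total (Vec.replicate n 3zeroAt) z + 3 * m ≤ n
      deviates z t rewrite total-3zeros z = toWitness {a? = unbalanced? z} t
      e₁ : ∀ m N → m * m * (27 * N) ≡ 3 * (3 * m * (3 * m)) * N
      e₁ = solve-∀
      e₂ : ∀ k c → 6 * (2 * k) * c ≡ k * (12 * c)
      e₂ = solve-∀

    #core-large : 3 ^ n ≤ 2 * #core
    #core-large = majority (3 ^ n) #core #steep #unbalanced cover steep-bound unbalanced-bound
      where
      open ≤-Reasoning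
      cover₁ : ∀ z → 1 ≤ ⟦ ⌊ core? z ⌋ ⟧ + (⟦ ⌊ steep? z ⌋ ⟧ + ⟦ ⌊ unbalanced? z ⌋ ⟧)
      cover₁ z with steep? z | unbalanced? z
      ... | yes _ | _     = ≤-trans (s≤s z≤n) (m≤n+m _ ⟦ ⌊ core? z ⌋ ⟧)
      ... | no _  | yes _ = ≤-trans (s≤s z≤n) (m≤n+m _ ⟦ ⌊ core? z ⌋ ⟧)
      ... | no ¬s | no ¬u with core? z
      ... | yes _ = s≤s z≤n
      ... | no ¬c = contradiction (balanced-core z ¬u ¬s) ¬c
      cover : 3 ^ n ≤ #core + (#steep + #unbalanced)
      cover = begin
        3 ^ n                                  ≡⟨ trans (∑-const P 1) (trans (*-identityʳ _) (length-allPoints n)) ⟨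
        ∑ P (const 1)                          ≤⟨ ∑-mono P cover₁ ⟩
        ∑ P _                                  ≡⟨ trans (∑-+ P _ _) (cong (#core +_) (∑-+ P _ _)) ⟩
        #core + (#steep + #unbalanced)         ∎

    module _ (S′ : CubeSet n) (closed : MidpointClosed S′) where

      differs : Point n → ℕ
      differs x = ⟦ antislab v x xor S′ x ⟧

      a R : ℕ
      a = 10 * m
      R = lo + 25 * m

      -- By `height-agree`, twice the agreements plus the zeros is the height. After painting the
      -- height is below n + 15m and at least lo zeros remain; as n ≤ 3(lo + 11m) + 2, this leaves
      -- about lo + 24m agreements, and the last m in R absorbs the rounding.
      painted-agree : ∀ u {z M} → IsMask a z M → ¬ Tall u z → lo + 10 * m ≤ zeros z → agree u (paint u M z) ≤ R
      painted-agree u {z} {M} mask ¬tall q≥ = *-cancelˡ-≤ 2 (≤-cert 1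
        (+-mono-≤ (≰⇒> ¬tall) (+-mono-≤ upper (+-mono-≤ q≥ (*-monoʳ-≤ 2 1≤m))))
        (begin
          2 * r + (n + 5 * m + (3 * (lo + 11 * m) + 2 + (zeros z + 2 * m))) + 1
            ≡⟨ cong (λ k → 2 * r + (n + 5 * m + (3 * (lo + 11 * m) + 2 + (k + 2 * m))) + 1) (paint-zeros u mask) ⟨
          2 * r + (n + 5 * m + (3 * (lo + 11 * m) + 2 + (q + 10 * m + 2 * m))) + 1
            ≡⟨ e₁ r q n m lo ⟩
          (2 * r + q) + (n + 3 * lo + 50 * m + 3)
            ≡⟨ cong (_+ (n + 3 * lo + 50 * m + 3)) (trans (sym (height-agree u x)) (paint-height u mask)) ⟩
          (height u z + 10 * m) + (n + 3 * lo + 50 * m + 3)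
            ≡⟨ e₂ (height u z) n m lo ⟩
          2 * (lo + 25 * m) + (suc (height u z) + (n + (lo + 10 * m + 2 * 1))) ∎))
        where
        open ≡-Reasoning
        x = paint u M z
        r = agree u x
        q = zeros x
        e₁ : ∀ r q n m lo → 2 * r + (n + 5 * m + (3 * (lo + 11 * m) + 2 + (q + 10 * m + 2 * m))) + 1 ≡ (2 * r + q) + (n + 3 * lo + 50 * m + 3)
        e₁ = solve-∀
        e₂ : ∀ h n m lo → (h + 10 * m) + (n + 3 * lo + 50 * m + 3) ≡ 2 * (lo + 25 * m) + (suc h + (n + (lo + 10 * m + 2 * 1)))
        e₂ = solve-∀

      -- The sum of heights makes w the opposite of u. As z is not tall for w, its height for u
      -- exceeds n - 5m, and 10m fills carry it across the whole slab.
      painted-tall : ∀ u w {z M} → height u z + height w z ≡ 2 * n → IsMask a z M → ¬ Tall w z →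
        Tall u (paint u M z)
      painted-tall u w {z} {M} sum≡ mask ¬tall = ≤-cert 1 (≰⇒> ¬tall) (begin
        n + 5 * m + (n + 5 * m) + 1                            ≡⟨ e₁ n m ⟩
        2 * n + (10 * m + 1)                                   ≡⟨ cong (_+ (10 * m + 1)) sum≡ ⟨
        height u z + height w z + (10 * m + 1)                 ≡⟨ e₂ (height u z) (height w z) m ⟩
        height u z + 10 * m + suc (height w z)                 ≡⟨ cong (_+ suc (height w z)) (paint-height u mask) ⟨
        height u (paint u M z) + suc (height w z)              ∎)
        where
        open ≡-Reasoning
        e₁ : ∀ n m → n + 5 * m + (n + 5 * m) + 1 ≡ 2 * n + (10 * m + 1)
        e₁ = solve-∀
        e₂ : ∀ h k m → h + k + (10 * m + 1) ≡ h + 10 * m + suc k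
        e₂ = solve-∀

      painted-zeros : ∀ u {z : Point n} {M} → IsMask a z M → lo + 10 * m ≤ zeros z → lo ≤ zeros (paint u M z)
      painted-zeros u mask q≥ = +-cancelʳ-≤ (10 * m) _ _ (≤-trans q≥ (≤-reflexive (sym (paint-zeros u mask))))

      core-mask : ∀ z {M} → T ⌊ core? z ⌋ → IsMask a z M →
        (agree v (paint v M z) ≤ R × agree (flip v) (paint (flip v) M z) ≤ R) ×
        1 ≤ differs z + (differs (paint v M z) + differs (paint (flip v) M z))
      core-mask z {M} c mask with toWitness {a? = core? z} c
      ... | (q≥ , q≤) , (¬t , ¬t̄) =
        (painted-agree v mask ¬t q≥ , painted-agree (flip v) mask ¬t̄ q≥) ,
        violation {antislab v z} {S′ z} {antislab v x} {S′ x} {antislab v y} {S′ y}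
          z∉ x∈ y∈ (closed x y z (paint-midpoint v mask))
        where
        x = paint v M z
        y = paint (flip v) M z
        z∉ : ¬ T (antislab v z)
        z∉ t with toWitness {a? = mem? v z} t
        ... | _ , inj₁ above          = <⇒≱ above q≤
        ... | _ , inj₂ (inj₁ tall)    = ¬t tall
        ... | _ , inj₂ (inj₂ tall)    = ¬t̄ tall
        x∈ : T (antislab v x)
        x∈ = fromWitness {a? = mem? v x}
          (painted-zeros v mask q≥ , inj₂ (inj₁ (painted-tall v (flip v) (height-flip v z) mask ¬t̄)))
        y∈ : T (antislab v y)
        y∈ = fromWitness {a? = mem? v y}
          (painted-zeros (flip v) mask q≥ ,
           inj₂ (inj₂ (painted-tall (flip v) v (trans (+-comm (height (flip v) z) _) (height-flip v z)) mask ¬t)))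

      Δ q₁ : ℕ
      Δ  = ∑ P differs
      q₁ = lo + 10 * m

      core-zeros : ∀ z → T ⌊ core? z ⌋ → q₁ ≤ zeros z × zeros z ≤ R
      core-zeros z c with toWitness {a? = core? z} c
      ... | (q≥ , q≤) , _ = q≥ , ≤-trans q≤ (+-monoʳ-≤ lo (*-monoˡ-≤ m (≤ᵇ⇒≤ 12 25 _)))

      charged : (q₁ C a) * #core ≤ (R C a) * (3 * Δ)
      charged = double-count v (flip v) (λ z → ⌊ core? z ⌋) differs core-zeros core-mask

      -- In the constant, 2 accounts for the core being half of the cube, 3 for the places in a
      -- triple, and 2^1000 for the ratio of C(R,10m) to C(q₁,10m).
      far : ∀ k → k ≡ 1000 → 3 ^ n ≤ 6 * 2 ^ k * ∣ antislab v △ S′ ∣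
      far k k≡1000 = begin
        3 ^ n                                ≤⟨ #core-large ⟩
        2 * #core                            ≤⟨ *-monoʳ-≤ 2 core≤ ⟩
        2 * (2 ^ k * (3 * Δ))                ≡⟨ e₁ (2 ^ k) Δ ⟩
        6 * 2 ^ k * Δ                        ≡⟨ cong (6 * 2 ^ k *_) (length-filterᵇ _ P) ⟨
        6 * 2 ^ k * ∣ antislab v △ S′ ∣      ∎
        where
        open ≤-Reasoning
        instance
          qC≢0 : NonZero (q₁ C a)
          qC≢0 = >-nonZero (C-pos (m≤n+m a lo))
        e₁ : ∀ k d → 2 * (k * (3 * d)) ≡ 6 * k * d
        e₁ = solve-∀
        e₂ : ∀ c k d → k * c * d ≡ c * (k * d)
        e₂ = solve-∀
        a≡ : a ≡ μ * k
        a≡ rewrite m≡100μ | k≡1000 = trans (sym (*-assoc 10 100 μ)) (*-comm 1000 μ)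
        R≡ : R ≡ q₁ + 15 * m
        R≡ = trans (cong (lo +_) (*-distribʳ-+ m 10 15)) (sym (+-assoc lo (10 * m) (15 * m)))
        ratio : (R C a) ≤ 2 ^ k * (q₁ C a)
        ratio = subst₂ (λ r b → (r C b) ≤ 2 ^ k * (q₁ C b)) (sym R≡) (sym a≡)
          (C-shift-≤ μ k q₁ (15 * m) (≤-trans (≤-reflexive (cong (_+ 2 * μ * (15 * m)) (sym a≡)))
            (≤-trans (+-monoʳ-≤ a lo≥) (≤-reflexive (+-comm a lo)))))
        core≤ : #core ≤ 2 ^ k * (3 * Δ)
        core≤ = *-cancelˡ-≤ (q₁ C a) (begin
          (q₁ C a) * #core                    ≤⟨ charged ⟩
          (R C a) * (3 * Δ)                   ≤⟨ *-monoˡ-≤ (3 * Δ) ratio ⟩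
          2 ^ k * (q₁ C a) * (3 * Δ)          ≡⟨ e₂ (q₁ C a) (2 ^ k) (3 * Δ) ⟩
          (q₁ C a) * (2 ^ k * (3 * Δ))        ∎)

  -- Random sign vectors

  allSigns : ∀ n → List (Signs n)
  allSigns zero    = [] ∷ []
  allSigns (suc n) = List.map (true ∷_) (allSigns n) ++ List.map (false ∷_) (allSigns n)

  ∑-allSigns : ∀ n (f : Signs (suc n) → ℕ) →
    ∑ (allSigns (suc n)) f ≡ ∑ (allSigns n) (f ∘ (true ∷_)) + ∑ (allSigns n) (f ∘ (false ∷_))
  ∑-allSigns n f = trans (∑-++ (List.map (true ∷_) (allSigns n)) _ f)
    (cong₂ _+_ (∑-map (true ∷_) (allSigns n) f) (∑-map (false ∷_) (allSigns n) f))

  length-allSigns : ∀ n → length (allSigns n) ≡ 2 ^ n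
  length-allSigns zero    = refl
  length-allSigns (suc n) = begin
    length (allSigns (suc n))         ≡⟨ *-identityʳ _ ⟨
    length (allSigns (suc n)) * 1     ≡⟨ ∑-const (allSigns (suc n)) 1 ⟨
    ∑ (allSigns (suc n)) (const 1)    ≡⟨ ∑-allSigns n (const 1) ⟩
    c + c
      ≡⟨ cong (λ k → k + k) (trans (∑-const (allSigns n) 1) (trans (*-identityʳ _) (length-allSigns n))) ⟩
    2 ^ n + 2 ^ n                     ≡⟨ cong (2 ^ n +_) (+-identityʳ (2 ^ n)) ⟨
    2 ^ suc n                         ∎
    where
    open ≡-Reasoning
    c = ∑ (allSigns n) (const 1)

  ∑-flip : ∀ n (f : Signs n → ℕ) → ∑ (allSigns n) (f ∘ flip) ≡ ∑ (allSigns n) f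
  ∑-flip zero    f = refl
  ∑-flip (suc n) f = begin
    ∑ (allSigns (suc n)) (f ∘ flip)
      ≡⟨ ∑-allSigns n (f ∘ flip) ⟩
    ∑ (allSigns n) (λ v → f (false ∷ flip v)) + ∑ (allSigns n) (λ v → f (true ∷ flip v))
      ≡⟨ cong₂ _+_ (∑-flip n (f ∘ (false ∷_))) (∑-flip n (f ∘ (true ∷_))) ⟩
    ∑ (allSigns n) (f ∘ (false ∷_)) + ∑ (allSigns n) (f ∘ (true ∷_))
      ≡⟨ +-comm (∑ (allSigns n) (f ∘ (false ∷_))) _ ⟩
    _ ≡⟨ ∑-allSigns n f ⟨
    ∑ (allSigns (suc n)) f ∎
    where open ≡-Reasoning

  -- short z x = Σ |z_i − x_i| over the support of z: it vanishes iff x extends z.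
  shortAt : Trit → Weight
  shortAt neg neg = 0
  shortAt neg zer = 1
  shortAt neg pos = 2
  shortAt zer _   = 0
  shortAt pos neg = 2
  shortAt pos zer = 1
  shortAt pos pos = 0

  short : ∀ {n} → Point n → Point n → ℕ
  short z = total (Vec.map shortAt z)

  short-refl : ∀ {n} (z : Point n) → short z z ≡ 0
  short-refl []        = refl
  short-refl (neg ∷ z) = short-refl z
  short-refl (zer ∷ z) = short-refl z
  short-refl (pos ∷ z) = short-refl z

  infix 4 _⊑_
  data _⊑_ : ∀ {n} → Point n → Point n → Set where
    []   : [] ⊑ []
    same : ∀ {n t} {z x : Point n} → z ⊑ x → t ∷ z ⊑ t ∷ x
    new  : ∀ {n} b {z x : Point n} → z ⊑ x → zer ∷ z ⊑ sign b ∷ x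

  short⇒⊑ : ∀ {n} (z x : Point n) → short z x ≡ 0 → z ⊑ x
  short⇒⊑ []        []        _ = []
  short⇒⊑ (neg ∷ z) (neg ∷ x) h = same (short⇒⊑ z x h)
  short⇒⊑ (zer ∷ z) (neg ∷ x) h = new false (short⇒⊑ z x h)
  short⇒⊑ (zer ∷ z) (zer ∷ x) h = same (short⇒⊑ z x h)
  short⇒⊑ (zer ∷ z) (pos ∷ x) h = new true (short⇒⊑ z x h)
  short⇒⊑ (pos ∷ z) (pos ∷ x) h = same (short⇒⊑ z x h)

  news : ∀ {n} {z x : Point n} → z ⊑ x → ℕ
  news []        = 0
  news (same e)  = news e
  news (new b e) = suc (news e)

  gain : ∀ {n} {z x : Point n} → Signs n → z ⊑ x → ℕ
  gain []      []        = 0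
  gain (b ∷ v) (same e)  = gain v e
  gain (b ∷ v) (new c e) = ⟦ not (b xor c) ⟧ + gain v e

  zeros-news : ∀ {n} {z x : Point n} (e : z ⊑ x) → zeros x + news e ≡ zeros z
  zeros-news []               = refl
  zeros-news (same {t = t} e) = trans (+-assoc (zeroAt t) _ _) (cong (zeroAt t +_) (zeros-news e))
  zeros-news (new true e)     = trans (+-suc _ _) (cong suc (zeros-news e))
  zeros-news (new false e)    = trans (+-suc _ _) (cong suc (zeros-news e))

  gain-flip : ∀ {n} {z x : Point n} (v : Signs n) (e : z ⊑ x) → gain v e + gain (flip v) e ≡ news e
  gain-flip []          []            = refl
  gain-flip (b ∷ v)     (same e)      = gain-flip v e
  gain-flip (true ∷ v)  (new true e)  = cong suc (gain-flip v e)
  gain-flip (true ∷ v)  (new false e) = trans (+-suc _ _) (cong suc (gain-flip v e))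
  gain-flip (false ∷ v) (new true e)  = trans (+-suc _ _) (cong suc (gain-flip v e))
  gain-flip (false ∷ v) (new false e) = cong suc (gain-flip v e)

  -- The subtraction-free form of ⟨v,x - z⟩ = gain - loss, where the loss for v is the gain for -v.
  height-gain : ∀ {n} {z x : Point n} (v : Signs n) (e : z ⊑ x) →
    height v x + gain (flip v) e ≡ height v z + gain v e
  height-gain []          []               = refl
  height-gain (b ∷ v)     (same {t = t} e) = trans (+-assoc (heightAt b t) _ _)
    (trans (cong (heightAt b t +_) (height-gain v e)) (sym (+-assoc (heightAt b t) _ _)))
  height-gain (true ∷ v)  (new true e)     = cong suc (trans (cong suc (height-gain v e)) (sym (+-suc _ _)))
  height-gain (true ∷ v)  (new false e)    = trans (+-suc _ _) (cong suc (height-gain v e))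
  height-gain (false ∷ v) (new true e)     = trans (+-suc _ _) (cong suc (height-gain v e))
  height-gain (false ∷ v) (new false e)    = cong suc (trans (cong suc (height-gain v e)) (sym (+-suc _ _)))

  -- The moment generating function of gain − loss at log (5/4), scaled by 20^news.
  mgf : ∀ {n} {z x : Point n} → Signs n → z ⊑ x → ℕ
  mgf v e = 25 ^ gain v e * 16 ^ gain (flip v) e

  -- By independence, each new entry contributes the mean (25 + 16)/2 and every other entry
  -- contributes 1.
  ∑-mgf : ∀ {n} {z x : Point n} (e : z ⊑ x) →
    ∑ (allSigns n) (λ v → mgf v e) * 2 ^ news e ≡ 2 ^ n * 41 ^ news e
  ∑-mgf []               = refl
  ∑-mgf {suc n} (same e) = begin
    ∑ (allSigns (suc n)) (λ v → mgf v (same e)) * 2 ^ news e   ≡⟨ cong (_* 2 ^ news e) (∑-allSigns n _) ⟩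
    (S + S) * 2 ^ news e                                       ≡⟨ e₁ S (2 ^ news e) ⟩
    2 * (S * 2 ^ news e)                                       ≡⟨ cong (2 *_) (∑-mgf e) ⟩
    2 * (2 ^ n * 41 ^ news e)                                  ≡⟨ *-assoc 2 (2 ^ n) _ ⟨
    2 ^ suc n * 41 ^ news e                                    ∎
    where
    open ≡-Reasoning
    S = ∑ (allSigns n) (λ v → mgf v e)
    e₁ : ∀ s t → (s + s) * t ≡ 2 * (s * t)
    e₁ = solve-∀
  ∑-mgf {suc n} (new c e) = begin
    ∑ (allSigns (suc n)) (λ v → mgf v (new c e)) * (2 * 2 ^ news e)
      ≡⟨ cong (_* (2 * 2 ^ news e)) (trans (∑-allSigns n _) (halves c)) ⟩
    41 * S * (2 * 2 ^ news e)                                         ≡⟨ e₁ S (2 ^ news e) ⟩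
    82 * (S * 2 ^ news e)                                             ≡⟨ cong (82 *_) (∑-mgf e) ⟩
    82 * (2 ^ n * 41 ^ news e)                                        ≡⟨ e₂ (2 ^ n) (41 ^ news e) ⟩
    2 * 2 ^ n * (41 * 41 ^ news e)                                    ∎
    where
    open ≡-Reasoning
    V = allSigns n
    S = ∑ V (λ v → mgf v e)
    won lost : ℕ
    won  = ∑ V (λ v → 25 ^ suc (gain v e) * 16 ^ gain (flip v) e)
    lost = ∑ V (λ v → 25 ^ gain v e * 16 ^ suc (gain (flip v) e))
    won≡ : won ≡ 25 * S
    won≡ = trans (∑-cong V (λ v → *-assoc 25 (25 ^ gain v e) _)) (∑-*ˡ V 25 _)
    lost≡ : lost ≡ 16 * S
    lost≡ = trans (∑-cong V (λ v → e₃ (25 ^ gain v e) 16 _)) (∑-*ˡ V 16 _)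
      where
      e₃ : ∀ a b d → a * (b * d) ≡ b * (a * d)
      e₃ = solve-∀
    halves : ∀ c → ∑ V (λ v → mgf (true ∷ v) (new c e)) + ∑ V (λ v → mgf (false ∷ v) (new c e)) ≡ 41 * S
    halves true  = trans (cong₂ _+_ won≡ lost≡) (sym (*-distribʳ-+ S 25 16))
    halves false = trans (cong₂ _+_ lost≡ won≡) (sym (*-distribʳ-+ S 16 25))
    e₁ : ∀ s t → 41 * s * (2 * t) ≡ 82 * (s * t)
    e₁ = solve-∀
    e₂ : ∀ s t → 82 * (s * t) ≡ 2 * s * (41 * t)
    e₂ = solve-∀

  -- Divided by 20^(g+l)·4^d this reads (5/4)^d ≤ (5/4)^(g-l), because 25 = 20·5/4 and 16 = 20·4/5.
  ^-exchange : ∀ {g l d} → l + d ≤ g → 5 ^ d * 20 ^ (g + l) ≤ 25 ^ g * 16 ^ l * 4 ^ d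
  ^-exchange {g} {l} {d} h = begin
    5 ^ d * 20 ^ (g + l)                                      ≡⟨ cong (5 ^ d *_) (^-distribˡ-+-* 20 g l) ⟩
    5 ^ d * (20 ^ g * 20 ^ l)                                 ≡⟨ cong (5 ^ d *_) (cong₂ _*_ (*-^ 5 4 g) (*-^ 5 4 l)) ⟩
    5 ^ d * (5 ^ g * 4 ^ g * (5 ^ l * 4 ^ l))
      ≡⟨ cong (λ k → 5 ^ d * (5 ^ g * k * (5 ^ l * 4 ^ l))) (expand 4) ⟩
    5 ^ d * (5 ^ g * (4 ^ l * 4 ^ d * 4 ^ e) * (5 ^ l * 4 ^ l))
      ≡⟨ e₁ (5 ^ d) (5 ^ g) (4 ^ l) (4 ^ d) (4 ^ e) (5 ^ l) ⟩
    c * 4 ^ e                                                 ≤⟨ *-monoʳ-≤ c (^-monoˡ-≤ e (n≤1+n 4)) ⟩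
    c * 5 ^ e                                                 ≡⟨ e₂ (5 ^ d) (5 ^ g) (4 ^ l) (4 ^ d) (5 ^ e) (5 ^ l) ⟩
    5 ^ g * (5 ^ l * 5 ^ d * 5 ^ e) * (4 ^ l * 4 ^ l) * 4 ^ d
      ≡⟨ cong (λ k → 5 ^ g * k * (4 ^ l * 4 ^ l) * 4 ^ d) (expand 5) ⟨
    5 ^ g * 5 ^ g * (4 ^ l * 4 ^ l) * 4 ^ d                   ≡⟨ cong (_* 4 ^ d) (cong₂ _*_ (*-^ 5 5 g) (*-^ 4 4 l)) ⟨
    25 ^ g * 16 ^ l * 4 ^ d                                   ∎
    where
    open ≤-Reasoning
    e = g ∸ (l + d)
    c = 5 ^ d * 5 ^ g * 4 ^ l * 4 ^ d * 5 ^ l * 4 ^ l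
    expand : ∀ b → b ^ g ≡ b ^ l * b ^ d * b ^ e
    expand b = trans (cong (b ^_) (sym (m+[n∸m]≡n h)))
      (trans (^-distribˡ-+-* b (l + d) e) (cong (_* b ^ e) (^-distribˡ-+-* b l d)))
    e₁ : ∀ p q r s t u → p * (q * (r * s * t) * (u * r)) ≡ p * q * r * s * u * r * t
    e₁ = solve-∀
    e₂ : ∀ p q r s t u → p * q * r * s * u * r * t ≡ q * (u * p * t) * (r * r) * s
    e₂ = solve-∀

  -- The exponential Markov inequality: the fraction of such v is at most (41/40)^news · (4/5)^d.
  chernoff : ∀ {n} {z x : Point n} (e : z ⊑ x) d (p : Signs n → Bool) →
    (∀ v → T (p v) → gain (flip v) e + d ≤ gain v e) →
    ∑ (allSigns n) (⟦_⟧ ∘ p) * (5 ^ d * 40 ^ news e) ≤ 2 ^ n * (41 ^ news e * 4 ^ d)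
  chernoff {n} e d p h = begin
    N * (5 ^ d * 40 ^ k)                    ≡⟨ cong (λ j → N * (5 ^ d * j)) (*-^ 20 2 k) ⟩
    N * (5 ^ d * (20 ^ k * 2 ^ k))          ≡⟨ e₁ N (5 ^ d) (20 ^ k) (2 ^ k) ⟩
    N * (5 ^ d * 20 ^ k) * 2 ^ k            ≤⟨ *-monoˡ-≤ (2 ^ k) markov ⟩
    S * 4 ^ d * 2 ^ k                       ≡⟨ e₂ S (4 ^ d) (2 ^ k) ⟩
    S * 2 ^ k * 4 ^ d                       ≡⟨ cong (_* 4 ^ d) (∑-mgf e) ⟩
    2 ^ n * 41 ^ k * 4 ^ d                  ≡⟨ *-assoc (2 ^ n) (41 ^ k) (4 ^ d) ⟩
    2 ^ n * (41 ^ k * 4 ^ d)                ∎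
    where
    open ≤-Reasoning
    V = allSigns n
    k = news e
    N = ∑ V (⟦_⟧ ∘ p)
    S = ∑ V (λ v → mgf v e)
    pointwise : ∀ v b → (T b → gain (flip v) e + d ≤ gain v e) → ⟦ b ⟧ * (5 ^ d * 20 ^ k) ≤ mgf v e * 4 ^ d
    pointwise v false _ = z≤n
    pointwise v true  h rewrite sym (gain-flip v e) = ≤-trans (≤-reflexive (*-identityˡ _)) (^-exchange {gain v e} {gain (flip v) e} (h _))
    markov : N * (5 ^ d * 20 ^ k) ≤ S * 4 ^ d
    markov = begin
      N * (5 ^ d * 20 ^ k)                       ≡⟨ ∑-*ʳ V _ _ ⟨
      ∑ V (λ v → ⟦ p v ⟧ * (5 ^ d * 20 ^ k))     ≤⟨ ∑-mono V (λ v → pointwise v (p v) (h v)) ⟩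
      ∑ V (λ v → mgf v e * 4 ^ d)                ≡⟨ ∑-*ʳ V _ _ ⟩
      S * 4 ^ d                                  ∎
    e₁ : ∀ a b c d → a * (b * (c * d)) ≡ a * (b * c) * d
    e₁ = solve-∀
    e₂ : ∀ a b c → a * b * c ≡ a * c * b
    e₂ = solve-∀

  -- Since p/q ≥ 1, its power grows with the exponent. This replaces the actual number of new
  -- entries by the bound 12m.
  power-weaken : ∀ {N A c p q d k w} → k ≤ w → q ≤ p →
    N * (c * q ^ k) ≤ A * (p ^ k * d) → N * (c * q ^ w) ≤ A * (p ^ w * d)
  power-weaken {N} {A} {c} {p} {q} {d} {k} {w} k≤w q≤p h = begin
    N * (c * q ^ w)                   ≡⟨ cong (λ j → N * (c * j)) (expand q) ⟩
    N * (c * (q ^ k * q ^ e))         ≡⟨ e₁ N c (q ^ k) (q ^ e) ⟩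
    N * (c * q ^ k) * q ^ e           ≤⟨ *-mono-≤ h (^-monoˡ-≤ e q≤p) ⟩
    A * (p ^ k * d) * p ^ e           ≡⟨ e₂ A (p ^ k) d (p ^ e) ⟩
    A * (p ^ k * p ^ e * d)           ≡⟨ cong (λ j → A * (j * d)) (expand p) ⟨
    A * (p ^ w * d)                   ∎
    where
    open ≤-Reasoning
    e = w ∸ k
    expand : ∀ b → b ^ w ≡ b ^ k * b ^ e
    expand b = trans (cong (b ^_) (sym (m+[n∸m]≡n k≤w))) (^-distribˡ-+-* b k e)
    e₁ : ∀ a b c d → a * (b * (c * d)) ≡ a * (b * c) * d
    e₁ = solve-∀
    e₂ : ∀ a b c d → a * (b * c) * d ≡ a * (b * d * c)
    e₂ = solve-∀

  halving : ∀ {N A x y} m → .{{NonZero x}} → 2 * x ≤ y → N * y ^ m ≤ A * x ^ m → N * 2 ^ m ≤ A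
  halving {N} {A} {x} {y} m 2x≤y h = *-cancelʳ-≤ _ _ (x ^ m) {{m^n≢0 x m}} (begin
    N * 2 ^ m * x ^ m       ≡⟨ *-assoc N (2 ^ m) (x ^ m) ⟩
    N * (2 ^ m * x ^ m)     ≡⟨ cong (N *_) (*-^ 2 x m) ⟨
    N * (2 * x) ^ m         ≤⟨ *-monoʳ-≤ N (^-monoˡ-≤ m 2x≤y) ⟩
    N * y ^ m               ≤⟨ h ⟩
    A * x ^ m               ∎)
    where open ≤-Reasoning

  ∈-∑ : ∀ {A : Set} {x : A} {xs} (f : A → ℕ) → x ∈ₗ xs → f x ≤ ∑ xs f
  ∈-∑ f (here refl)           = m≤m+n _ _
  ∈-∑ f (there {x = y} x∈xs)  = ≤-trans (∈-∑ f x∈xs) (m≤n+m _ (f y))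

  -- Pairs of queries that detect the anti-slab

  module Queries (n m lo : ℕ) where
    open Antislab n m lo

    -- Membership is kept out on purpose. For a fixed pair the first two conditions do not involve v
    -- and the third is a tail event, so the union bound can run over pairs fixed before v is drawn.
    Caught : Point n → Point n → Signs n → Set
    Caught z x v = short z x ≡ 0 × zeros z ≤ zeros x + 12 * m × height v z + 5 * m ≤ height v x

    caught? : ∀ z x v → Dec (Caught z x v)
    caught? z x v = short z x ≟ 0 ×-dec zeros z ≤? zeros x + 12 * m ×-dec height v z + 5 * m ≤? height v x

    private
      V = allSigns n

    #caught : Point n → Point n → ℕ
    #caught z x = ∑ V (λ v → ⟦ ⌊ caught? z x v ⌋ ⟧)

    caught-rare : ∀ z x → #caught z x * 2 ^ m ≤ 2 ^ n
    caught-rare z x = rare (short z x ≟ 0) (zeros z ≤? zeros x + 12 * m)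
      where
      open ≤-Reasoning
      N = #caught z x
      X = 41 ^ 12 * 4 ^ 5
      Y = 5 ^ 5 * 40 ^ 12

      never : (∀ v → ¬ Caught z x v) → N * 2 ^ m ≤ 2 ^ n
      never h = begin
        N * 2 ^ m
          ≤⟨ *-monoˡ-≤ (2 ^ m) (∑-mono V λ v → ⟦⟧-≤ _ λ t → contradiction (toWitness {a? = caught? z x v} t) (h v)) ⟩
        ∑ V (const 0) * 2 ^ m     ≡⟨ cong (_* 2 ^ m) (trans (∑-const V 0) (*-zeroʳ (length V))) ⟩
        0                         ≤⟨ z≤n ⟩
        2 ^ n                     ∎

      ^-split : ∀ p q i j → (p ^ i * q ^ j) ^ m ≡ p ^ (i * m) * q ^ (j * m)
      ^-split p q i j = trans (*-^ (p ^ i) (q ^ j) m) (cong₂ _*_ (^-*-assoc p i m) (^-*-assoc q j m))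

      rare : Dec (short z x ≡ 0) → Dec (zeros z ≤ zeros x + 12 * m) → N * 2 ^ m ≤ 2 ^ n
      rare (no ¬s) _        = never λ v c → ¬s (proj₁ c)
      rare (yes _) (no ¬q)  = never λ v c → ¬q (proj₁ (proj₂ c))
      -- The numerical fact behind the choice of 5m and 12m: (41/40)^12 · (4/5)^5 is about 0.44,
      -- hence at most 1/2.
      rare (yes s) (yes q≤) = halving {N} {2 ^ n} {X} {Y} m (≤ᵇ⇒≤ (2 * X) Y _) (begin
        N * Y ^ m                               ≡⟨ cong (N *_) (^-split 5 40 5 12) ⟩
        N * (5 ^ (5 * m) * 40 ^ (12 * m))
          ≤⟨ power-weaken {N} {2 ^ n} {5 ^ (5 * m)} {41} {40} {4 ^ (5 * m)} news≤ (n≤1+n 40) (chernoff e (5 * m) _ gains) ⟩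
        2 ^ n * (41 ^ (12 * m) * 4 ^ (5 * m))   ≡⟨ cong (2 ^ n *_) (^-split 41 4 12 5) ⟨
        2 ^ n * X ^ m                           ∎)
        where
        e = short⇒⊑ z x s
        news≤ : news e ≤ 12 * m
        news≤ = +-cancelˡ-≤ (zeros x) _ _ (≤-trans (≤-reflexive (zeros-news e)) q≤)
        gains : ∀ v → T ⌊ caught? z x v ⌋ → gain (flip v) e + 5 * m ≤ gain v e
        gains v t = ≤-cert 0 (proj₂ (proj₂ (toWitness {a? = caught? z x v} t))) (begin-equality
          gain (flip v) e + 5 * m + height v x + 0      ≡⟨ e₁ (gain (flip v) e) (5 * m) (height v x) ⟩
          height v x + gain (flip v) e + 5 * m          ≡⟨ cong (_+ 5 * m) (height-gain v e) ⟩
          height v z + gain v e + 5 * m                 ≡⟨ e₂ (height v z) (gain v e) (5 * m) ⟩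
          gain v e + (height v z + 5 * m)               ∎)
          where
          e₁ : ∀ a b c → a + b + c + 0 ≡ c + a + b
          e₁ = solve-∀
          e₂ : ∀ a b c → a + b + c ≡ b + (a + c)
          e₂ = solve-∀

    Detects : List (Point n) → Signs n → Set
    Detects qs v = ∃ λ z → ∃ λ x → z ∈ₗ qs × x ∈ₗ qs × (Caught z x v ⊎ Caught z x (flip v))

    detections : List (Point n) → Signs n → ℕ
    detections qs v = ∑ qs (λ z → ∑ qs (λ x → ⟦ ⌊ caught? z x v ⌋ ⟧ + ⟦ ⌊ caught? z x (flip v) ⌋ ⟧))

    -- A union bound over ordered pairs; the factor 2 is for v and -v, which have the same
    -- distribution.
    detections-rare : ∀ qs → ∑ V (detections qs) * 2 ^ m ≤ 2 * (length qs * length qs) * 2 ^ n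
    detections-rare qs = begin
      ∑ V (detections qs) * 2 ^ m
        ≡⟨ cong (_* 2 ^ m) (trans (∑-swap V qs _) (∑-cong qs λ z → trans (∑-swap V qs _) (∑-cong qs λ x → total-caught z x))) ⟩
      ∑ qs (λ z → ∑ qs (λ x → 2 * #caught z x)) * 2 ^ m
        ≡⟨ trans (sym (∑-*ʳ qs _ _)) (∑-cong qs λ z → sym (∑-*ʳ qs _ _)) ⟩
      ∑ qs (λ z → ∑ qs (λ x → 2 * #caught z x * 2 ^ m))
        ≤⟨ ∑-mono qs (λ z → ∑-mono qs λ x → ≤-trans (≤-reflexive (*-assoc 2 (#caught z x) (2 ^ m))) (*-monoʳ-≤ 2 (caught-rare z x))) ⟩
      ∑ qs (λ z → ∑ qs (λ x → 2 * 2 ^ n))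
        ≡⟨ trans (∑-cong qs λ z → ∑-const qs _) (∑-const qs _) ⟩
      length qs * (length qs * (2 * 2 ^ n))
        ≡⟨ e₁ (length qs) (2 ^ n) ⟩
      2 * (length qs * length qs) * 2 ^ n ∎
      where
      open ≤-Reasoning
      e₁ : ∀ l c → l * (l * (2 * c)) ≡ 2 * (l * l) * c
      e₁ = solve-∀
      total-caught : ∀ z x → ∑ V (λ v → ⟦ ⌊ caught? z x v ⌋ ⟧ + ⟦ ⌊ caught? z x (flip v) ⌋ ⟧) ≡ 2 * #caught z x
      total-caught z x = trans (∑-+ V _ _) (cong (#caught z x +_) (trans (∑-flip n _) (sym (+-identityʳ _))))

    detections-detects : ∀ qs v → detections qs v ≡ 0 → ¬ Detects qs v
    detections-detects qs v none (z , x , z∈ , x∈ , c) = <⇒≱ (pos′ c) (≤-trans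
      (≤-trans (∈-∑ _ x∈) (∈-∑ (λ z → ∑ qs (λ x → ⟦ ⌊ caught? z x v ⌋ ⟧ + ⟦ ⌊ caught? z x (flip v) ⌋ ⟧)) z∈)) (≤-reflexive none))
      where
      pos′ : Caught z x v ⊎ Caught z x (flip v) → 1 ≤ ⟦ ⌊ caught? z x v ⌋ ⟧ + ⟦ ⌊ caught? z x (flip v) ⌋ ⟧
      pos′ (inj₁ c) = ≤-trans (⟦⟧-true _ (fromWitness {a? = caught? z x v} c)) (m≤m+n _ _)
      pos′ (inj₂ c) = ≤-trans (⟦⟧-true _ (fromWitness {a? = caught? z x (flip v)} c)) (m≤n+m _ _)

  -- Separation by half-spaces

  -- A vanishing second difference: the weight is then the restriction of an affine function on ℝ,
  -- so the bound on the total describes a genuine half-space of ℝⁿ.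
  Affine : Weight → Set
  Affine w = w neg + w pos ≡ w zer + w zer

  record Halfspace (n : ℕ) : Set where
    constructor halfspace
    field
      weights : Vec Weight n
      affine  : VAll Affine weights
      bound   : ℕ

    Inside : Point n → Set
    Inside x = bound ≤ total weights x

  open Halfspace using (Inside)

  inside? : ∀ {n} (hs : List (Halfspace n)) x → Dec (All (λ h → Inside h x) hs)
  inside? hs x = all? (λ h → Halfspace.bound h ≤? total (Halfspace.weights h) x) hs

  polyhedron : ∀ {n} → List (Halfspace n) → CubeSet n
  polyhedron hs x = ⌊ inside? hs x ⌋

  separatorAt : ℕ → Bool → Trit → Weight
  separatorAt k b t s = k * shortAt t s + heightAt b s

  separatorAt-affine : ∀ k b t → Affine (separatorAt k b t)
  separatorAt-affine k b t = trans (interchange (k * shortAt t neg) (heightAt b neg) _ _)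
    (trans (cong₂ _+_ (trans (sym (*-distribˡ-+ k (shortAt t neg) (shortAt t pos)))
       (trans (cong (k *_) (shortAt-affine t)) (*-distribˡ-+ k (shortAt t zer) (shortAt t zer)))) (heightAt-affine b))
      (interchange (k * shortAt t zer) (k * shortAt t zer) _ _))
    where
    interchange : ∀ a b c d → a + b + (c + d) ≡ a + c + (b + d)
    interchange = solve-∀
    shortAt-affine : ∀ t → Affine (shortAt t)
    shortAt-affine neg = refl
    shortAt-affine zer = refl
    shortAt-affine pos = refl
    heightAt-affine : ∀ b → Affine (heightAt b)
    heightAt-affine true  = refl
    heightAt-affine false = refl

  separatorWeights : ∀ {n} → ℕ → Signs n → Point n → Vec Weight n
  separatorWeights k = Vec.zipWith (separatorAt k)

  separatorWeights-affine : ∀ {n} k (v : Signs n) z → VAll Affine (separatorWeights k v z)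
  separatorWeights-affine k []      []      = []
  separatorWeights-affine k (b ∷ v) (t ∷ z) = separatorAt-affine k b t ∷ separatorWeights-affine k v z

  total-separator : ∀ {n} k (v : Signs n) z x → total (separatorWeights k v z) x ≡ k * short z x + height v x
  total-separator k []      []      []      = cong (_+ 0) (sym (*-zeroʳ k))
  total-separator k (b ∷ v) (t ∷ z) (s ∷ x) = trans (cong (separatorAt k b t s +_) (total-separator k v z x))
    (eq k (shortAt t s) (heightAt b s) (short z x) (height v x))
    where
    eq : ∀ k a h s r → k * a + h + (k * s + r) ≡ k * (a + s) + (h + r)
    eq = solve-∀

  -- On extensions of z this half-space says height v x > height v z;
  -- every other point of the cube satisfies it because short z x ≥ 1.
  separator : ∀ {n} → Signs n → Point n → Halfspace n
  separator v z = halfspace (separatorWeights k v z) (separatorWeights-affine k v z) k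
    where k = suc (height v z)

  separator-excludes : ∀ {n} (v : Signs n) z → ¬ Inside (separator v z) z
  separator-excludes v z in′ = <⇒≱ {height v z} ≤-refl (≤-trans in′ (≤-reflexive
    (trans (total-separator k v z z) (cong (_+ height v z) (trans (cong (k *_) (short-refl z)) (*-zeroʳ k))))))
    where k = suc (height v z)

  separator-includes : ∀ {n} (v : Signs n) z x → (short z x ≡ 0 → height v z < height v x) → Inside (separator v z) x
  separator-includes v z x h = ≤-trans (go (short z x) h) (≤-reflexive (sym (total-separator k v z x)))
    where
    k = suc (height v z)
    go : ∀ s → (s ≡ 0 → k ≤ height v x) → k ≤ k * s + height v x
    go zero    h = ≤-trans (h refl) (m≤n+m (height v x) (k * 0))
    go (suc s) _ = ≤-trans (m≤m*n k (suc s)) (m≤m+n (k * suc s) (height v x))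

  Separable : ∀ {n} → List (Point n) → CubeSet n → Point n → Set
  Separable qs S z = ∃ λ h → ¬ Inside h z × (∀ {x} → x ∈ₗ qs → x ∈ S → Inside h x)

  separate : ∀ {n} (qs : List (Point n)) (S : CubeSet n) zs →
    (∀ {z} → z ∈ₗ zs → ¬ z ∈ S → Separable qs S z) →
    ∃ λ hs → (∀ {x} → x ∈ₗ qs → x ∈ S → All (λ h → Inside h x) hs) ×
      (∀ {z} → z ∈ₗ zs → ¬ z ∈ S → ¬ All (λ h → Inside h z) hs)
  separate qs S []       sep = [] , (λ _ _ → []) , λ ()
  separate qs S (z ∷ zs) sep with separate qs S zs (sep ∘ there) | T? (S z)
  ... | hs , inc , exc | yes z∈S = hs , inc , λ where
    (here refl) z∉S → contradiction z∈S z∉S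
    (there z∈)  z∉S → exc z∈ z∉S
  ... | hs , inc , exc | no z∉S with sep (here refl) z∉S
  ... | h , out , ins = h ∷ hs , (λ x∈ x∈S → ins x∈ x∈S ∷ inc x∈ x∈S) , λ where
    (here refl) _   (hz ∷ _)  → out hz
    (there z∈)  z∉S (_ ∷ hsz) → exc z∈ z∉S hsz

  ≡-from-T : ∀ {b c} → (T b → T c) → (¬ T b → ¬ T c) → b ≡ c
  ≡-from-T {true}  {true}  _ _ = refl
  ≡-from-T {true}  {false} f _ = contradiction _ f
  ≡-from-T {false} {true}  _ g = contradiction _ (g λ ())
  ≡-from-T {false} {false} _ _ = refl

  polyhedral-agreement : ∀ {n} (qs : List (Point n)) (S : CubeSet n) →
    (∀ {z} → z ∈ₗ qs → ¬ z ∈ S → Separable qs S z) →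
    ∃ λ hs → ∀ {q} → q ∈ₗ qs → S q ≡ polyhedron hs q
  polyhedral-agreement qs S sep with separate qs S qs sep
  ... | hs , inc , exc = hs , λ {q} q∈ → ≡-from-T
    (λ q∈S → fromWitness {a? = inside? hs q} (inc q∈ q∈S))
    (λ q∉S t → exc q∈ q∉S (toWitness {a? = inside? hs q} t))

  -- Undetected answers agree with a polyhedron

  module Consistency (n m lo : ℕ) (qs : List (Point n)) (v : Signs n)
    (undetected : ¬ Queries.Detects n m lo qs v) where
    open Antislab n m lo
    open Queries n m lo

    S : CubeSet n
    S = antislab v

    Below : Point n → Point n → Set
    Below z x = x ∈ S × short z x ≡ 0 × height v x ≤ height v z

    below? : ∀ z x → Dec (Below z x)
    below? z x = T? (S x) ×-dec short z x ≟ 0 ×-dec height v x ≤? height v z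

    -- The separator in direction v fails only if a queried member y extends z without being higher.
    -- Then direction -v works: a second failure would need a member x ⊒ z tall for v, while y is
    -- tall for -v, and absence of detections would put z strictly on both sides of the central
    -- hyperplane.
    separable : ∀ {z} → z ∈ₗ qs → ¬ z ∈ S → Separable qs S z
    separable {z} z∈ z∉S with any? (below? z) qs
    ... | no none = separator v z , separator-excludes v z , λ {x} x∈ x∈S →
      separator-includes v z x λ ext → ≰⇒> λ low → none (lose x∈ (x∈S , ext , low))
    ... | yes some with find some
    ... | y , y∈ , y∈S , y-ext , y-low = separator (flip v) z , separator-excludes (flip v) z , λ {x} x∈ x∈S →
      separator-includes (flip v) z x (above x∈ x∈S)
      where
      zeros-≤ : ∀ {x} → short z x ≡ 0 → zeros x ≤ zeros z
      zeros-≤ {x} ext = ≤-trans (m≤m+n _ _) (≤-reflexive (zeros-news (short⇒⊑ z x ext)))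
      -- Extending z only removes zeros, so the member y forces z to have at least lo of them. As a
      -- non-member, z therefore lies in the middle layers and inside the slab.
      lo≤z : lo ≤ zeros z
      lo≤z = ≤-trans (proj₁ (toWitness {a? = mem? v y} y∈S)) (zeros-≤ y-ext)
      z≤hi : zeros z ≤ lo + 12 * m
      z≤hi = ≮⇒≥ λ hi → z∉S (fromWitness {a? = mem? v z} (lo≤z , inj₁ hi))
      z-¬tall : ¬ Tall v z
      z-¬tall t = z∉S (fromWitness {a? = mem? v z} (lo≤z , inj₂ (inj₁ t)))
      z-¬tall′ : ¬ Tall (flip v) z
      z-¬tall′ t = z∉S (fromWitness {a? = mem? v z} (lo≤z , inj₂ (inj₂ t)))
      steep : ∀ {x} → x ∈ S → short z x ≡ 0 → Tall v x ⊎ Tall (flip v) x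
      steep {x} x∈S ext with toWitness {a? = mem? v x} x∈S
      ... | _ , inj₁ hi = contradiction (≤-trans (zeros-≤ ext) z≤hi) (<⇒≱ hi)
      ... | _ , inj₂ t  = t
      near : ∀ {x} → x ∈ S → zeros z ≤ zeros x + 12 * m
      near {x} x∈S = ≤-trans z≤hi (+-monoˡ-≤ (12 * m) (proj₁ (toWitness {a? = mem? v x} x∈S)))
      -- If u is tall at x ⊒ z, then z itself lies on the u-side of the slab, as z and x are not a detection.
      u-side : ∀ u {x} → ¬ Caught z x u → x ∈ S → short z x ≡ 0 → Tall u x → n < height u z
      u-side u {x} ¬c x∈S ext tall = +-cancelʳ-< (5 * m) _ _ (≤-<-trans tall (≰⇒> λ h → ¬c (ext , near x∈S , h)))
      above : ∀ {x} → x ∈ₗ qs → x ∈ S → short z x ≡ 0 → height (flip v) z < height (flip v) x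
      above {x} x∈ x∈S ext with steep x∈S ext
      ... | inj₂ tall = <-≤-trans (≰⇒> z-¬tall′) tall
      ... | inj₁ tall with steep y∈S y-ext
      ... | inj₁ y-tall = contradiction (≤-trans y-tall y-low) z-¬tall
      -- Both heights of z would exceed n, but they add up to 2n.
      ... | inj₂ y-tall = contradiction (height-flip v z) (>⇒≢ (≤-<-trans (≤-reflexive (cong (n +_) (+-identityʳ n)))
        (+-mono-< (u-side v (λ c → undetected (z , x , z∈ , x∈ , inj₁ c)) x∈S ext tall)
          (u-side (flip v) (λ c → undetected (z , y , z∈ , y∈ , inj₂ c)) y∈S y-ext y-tall))))

    agreement : ∃ λ hs → ∀ {q} → q ∈ₗ qs → antislab v q ≡ polyhedron hs q
    agreement = polyhedral-agreement qs S separable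

  map-cong-∈ : ∀ {A B : Set} {f g : A → B} {s} (xs : Vec A s) → (∀ {x} → x ∈ₗ Vec.toList xs → f x ≡ g x) →
    Vec.map f xs ≡ Vec.map g xs
  map-cong-∈ []       h = refl
  map-cong-∈ (x ∷ xs) h = cong₂ _∷_ (h (here refl)) (map-cong-∈ xs (h ∘ there))

  #rejected : ∀ {n} → Deterministic n → (Signs n → CubeSet n) → ℕ
  #rejected {n} D S = ∑ (allSigns n) (λ v → ⟦ not (Deterministic.run D (S v)) ⟧)

  module _ {n m lo : ℕ} where
    open Antislab n m lo
    open Queries n m lo

    -- A rejection requires a detection, since undetected answers are those of an accepted
    -- polyhedron. The union bound 2q²/2^m on detections is at most 1/2 by `few`.
    rejections-rare : (D : Deterministic n) → (∀ hs → Deterministic.run D (polyhedron hs) ≡ true) →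
      ∀ {q} → Deterministic.size D ≤ q → 4 * (q * q) ≤ 2 ^ m → 2 * #rejected D antislab ≤ 2 ^ n
    rejections-rare D accepts {q} s≤q few = *-cancelʳ-≤ _ _ (2 ^ m) {{m^n≢0 2 m}} (begin
      2 * #rejected D antislab * 2 ^ m
        ≤⟨ *-monoˡ-≤ (2 ^ m) (*-monoʳ-≤ 2 (∑-mono (allSigns n) detected)) ⟩
      2 * ∑ (allSigns n) (detections qs) * 2 ^ m    ≡⟨ *-assoc 2 (∑ (allSigns n) (detections qs)) (2 ^ m) ⟩
      2 * (∑ (allSigns n) (detections qs) * 2 ^ m)  ≤⟨ *-monoʳ-≤ 2 (detections-rare qs) ⟩
      2 * (2 * (length qs * length qs) * 2 ^ n)
        ≡⟨ cong (λ l → 2 * (2 * (l * l) * 2 ^ n)) (length-toList queries) ⟩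
      2 * (2 * (size * size) * 2 ^ n)
        ≤⟨ *-monoʳ-≤ 2 (*-monoˡ-≤ (2 ^ n) (*-monoʳ-≤ 2 (*-mono-≤ s≤q s≤q))) ⟩
      2 * (2 * (q * q) * 2 ^ n)                     ≡⟨ e₁ (q * q) (2 ^ n) ⟩
      2 ^ n * (4 * (q * q))                         ≤⟨ *-monoʳ-≤ (2 ^ n) few ⟩
      2 ^ n * 2 ^ m                                 ∎)
      where
      open ≤-Reasoning
      open Deterministic D
      qs = Vec.toList queries
      e₁ : ∀ k c → 2 * (2 * k * c) ≡ c * (4 * k)
      e₁ = solve-∀
      accepted : ∀ v → ¬ Detects qs v → run (antislab v) ≡ true
      accepted v undetected with Consistency.agreement n m lo qs v undetected
      ... | hs , agree = trans (cong decide (map-cong-∈ queries agree)) (accepts hs)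
      detected : ∀ v → ⟦ not (run (antislab v)) ⟧ ≤ detections qs v
      detected v = ⟦⟧-≤ _ λ rejected → n≢0⇒n>0 λ none →
        subst (T ∘ not) (accepted v (detections-detects qs v none)) rejected

  -- Choice of scales

  bracket : (f : ℕ → ℕ) → f 0 ≡ 0 → (∀ i → f i < f (suc i)) → ∀ n → ∃ λ i → f i ≤ n × n < f (suc i)
  bracket f f0 mono zero    = 0 , ≤-reflexive f0 , subst (_< f 1) f0 (mono 0)
  bracket f f0 mono (suc n) with bracket f f0 mono n
  ... | i , fi≤n , n<f with suc n <? f (suc i)
  ... | yes sn<f = i , m≤n⇒m≤1+n fi≤n , sn<f
  ... | no  sn≮f = suc i , ≮⇒≥ sn≮f , ≤-<-trans n<f (mono (suc i))

  square : ℕ → ℕ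
  square k = k * k

  square-mono-≤ : ∀ {k l} → k ≤ l → square k ≤ square l
  square-mono-≤ h = *-mono-≤ h h

  square-cancel-< : ∀ {k l} → square k < square l → k < l
  square-cancel-< h = ≰⇒> λ l≤k → <⇒≱ h (square-mono-≤ l≤k)

  -- As 400 = 100·4, it ensures μ ≥ 4, which `next-square-≤` and `width-≤` need, and m ≥ 400, well
  -- above the 104 that occurs in `few-queries`.
  n₀ : ℕ
  n₀ = square 400

  record Scaled (n : ℕ) : Set where
    field
      {m lo} : ℕ
      scale  : Scale n m lo
      m≥     : 400 ≤ m
      n<     : n < square (m + 100)

  next-square-≤ : ∀ g {μ} → 4 ≤ μ → square (g * suc μ) ≤ 2 * square (g * μ)
  next-square-≤ g 4≤μ with m≤n⇒∃[o]m+o≡n 4≤μ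
  ... | ν , refl = ≤-cert (g * g * (ν * ν + 6 * ν + 7)) z≤n (eq g ν)
    where
    eq : ∀ g ν → g * suc (4 + ν) * (g * suc (4 + ν)) + 0 + g * g * (ν * ν + 6 * ν + 7) ≡ 2 * (g * (4 + ν) * (g * (4 + ν))) + 0
    eq = solve-∀

  -- The leading terms are 90gμ² and 100gμ². For g = 100 the right side is m², so this secures the
  -- room below n/3 that `lo≥` demands; the scale 100 in m = 100μ is chosen to exceed 90.
  width-≤ : ∀ g {μ} → 2 ≤ g → 4 ≤ μ → 3 * (2 * μ * (15 * (g * μ)) + 11 * (g * μ)) + 2 ≤ g * (100 * (μ * μ))
  width-≤ g 2≤g 4≤μ with m≤n⇒∃[o]m+o≡n 4≤μ
  ... | ν , refl = ≤-cert (g * (10 * (ν * ν) + 47 * ν + 27)) 2≤g (eq g ν)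
    where
    eq : ∀ g ν → 3 * (2 * (4 + ν) * (15 * (g * (4 + ν))) + 11 * (g * (4 + ν))) + 2 + g + g * (10 * (ν * ν) + 47 * ν + 27) ≡
      g * (100 * ((4 + ν) * (4 + ν))) + 2
    eq = solve-∀

  thirds : ∀ n d e → 3 * (e + d) + 2 ≤ n → ∃ λ l → 3 * (l + d) ≤ n × n ≤ 3 * (l + d) + 2 × e ≤ l
  thirds n d e h = t ∸ d , subst (λ k → 3 * k ≤ n) (sym l+d) 3t≤n , subst (λ k → n ≤ 3 * k + 2) (sym l+d) n≤3t+2 ,
    +-cancelʳ-≤ d _ _ (≤-trans e+d≤t (≤-reflexive (sym l+d)))
    where
    t = n / 3
    n≡ : n ≡ n % 3 + t * 3
    n≡ = m≡m%n+[m/n]*n n 3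
    3t≤n : 3 * t ≤ n
    3t≤n = ≤-trans (≤-reflexive (*-comm 3 t)) (≤-trans (m≤n+m (t * 3) (n % 3)) (≤-reflexive (sym n≡)))
    n≤3t+2 : n ≤ 3 * t + 2
    n≤3t+2 = ≤-trans (≤-reflexive n≡) (≤-trans (+-monoˡ-≤ (t * 3) (≤-pred (m%n<n n 3)))
      (≤-reflexive (trans (+-comm 2 (t * 3)) (cong (_+ 2) (*-comm t 3)))))
    e+d≤t : e + d ≤ t
    e+d≤t = *-cancelˡ-≤ 3 (+-cancelʳ-≤ 2 _ _ (≤-trans h n≤3t+2))
    l+d : t ∸ d + d ≡ t
    l+d = m∸n+n≡m (≤-trans (m≤n+m d e) e+d≤t)

  scaled : ∀ n → n₀ ≤ n → Scaled n
  scaled n n₀≤n with bracket (λ i → square (100 * i)) refl (λ i → *-mono-< (*-monoʳ-< 100 (n<1+n i)) (*-monoʳ-< 100 (n<1+n i))) n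
  ... | μ , low , high = record
    { m     = 100 * μ
    ; lo    = proj₁ third
    ; scale = record
      { μ      = μ
      ; μ≢0    = >-nonZero (≤-trans (s≤s z≤n) 4≤μ)
      ; m≡100μ = refl
      ; n≤2m²  = ≤-trans (<⇒≤ high) (next-square-≤ 100 4≤μ)
      ; lower  = proj₁ (proj₂ third)
      ; upper  = proj₁ (proj₂ (proj₂ third))
      ; lo≥    = proj₂ (proj₂ (proj₂ third))
      }
    ; m≥ = *-monoʳ-≤ 100 4≤μ
    ; n< = subst (n <_) (cong square (trans (*-suc 100 μ) (+-comm 100 (100 * μ)))) high
    }
    where
    4≤μ : 4 ≤ μ
    4≤μ = ≤-pred (*-cancelˡ-< 100 4 (suc μ) (square-cancel-< (≤-<-trans n₀≤n high)))
    e₁ : ∀ g h μ → g * (h * (μ * μ)) ≡ g * μ * (h * μ)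
    e₁ = solve-∀
    third = thirds n (11 * (100 * μ)) (2 * μ * (15 * (100 * μ)))
      (≤-trans (width-≤ 100 (s≤s (s≤s z≤n)) 4≤μ) (≤-trans (≤-reflexive (e₁ 100 100 μ)) low))

  -- Bounding 3 by 4 makes everything a power of 2: q is below 4^(√n/8) = 2^(√n/4), so 4q² is below
  -- 2^(2 + √n/2), while √n < m + 100. Failure would therefore mean m < 2 + (m + 100)/2, that is m <
  -- 104.
  few-queries : ∀ {a b m n q} → .{{NonZero b}} → 400 ≤ m → n < square (m + 100) →
    64 * square a ≤ square b * n → q ^ b < 3 ^ a → 4 * (q * q) ≤ 2 ^ m
  few-queries {a} {b} {m} {n} {q} m≥ n< a²≤ q< = ≮⇒≥ λ many → <⇒≱ (m<104 many) (≤-trans (≤ᵇ⇒≤ 104 400 _) m≥)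
    where
    open ≤-Reasoning
    8a< : 8 * a < b * (m + 100)
    8a< = square-cancel-< (begin-strict
      square (8 * a)                ≡⟨ e₁ a ⟩
      64 * square a                 ≤⟨ a²≤ ⟩
      square b * n                  <⟨ *-monoʳ-< (square b) {{m*n≢0 b b}} n< ⟩
      square b * square (m + 100)   ≡⟨ e₂ b (m + 100) ⟩
      square (b * (m + 100))        ∎)
      where
      e₁ : ∀ a → 8 * a * (8 * a) ≡ 64 * (a * a)
      e₁ = solve-∀
      e₂ : ∀ b c → b * b * (c * c) ≡ b * c * (b * c)
      e₂ = solve-∀
    module _ (many : 2 ^ m < 4 * (q * q)) where
      powers : 2 ^ (m * b) < 2 ^ (2 * b + 4 * a)
      powers = begin-strict
        2 ^ (m * b)                        ≡⟨ ^-*-assoc 2 m b ⟨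
        (2 ^ m) ^ b                        <⟨ ^-monoˡ-< b many ⟩
        (4 * (q * q)) ^ b                  ≡⟨ trans (*-^ 4 (q * q) b) (cong (4 ^ b *_) (*-^ q q b)) ⟩
        4 ^ b * (q ^ b * q ^ b)            ≤⟨ *-monoʳ-≤ (4 ^ b) (*-mono-≤ q≤ q≤) ⟩
        4 ^ b * (4 ^ a * 4 ^ a)
          ≡⟨ cong₂ _*_ (^-*-assoc 2 2 b) (cong₂ _*_ (^-*-assoc 2 2 a) (^-*-assoc 2 2 a)) ⟩
        2 ^ (2 * b) * (2 ^ (2 * a) * 2 ^ (2 * a))
          ≡⟨ cong (2 ^ (2 * b) *_) (^-distribˡ-+-* 2 (2 * a) (2 * a)) ⟨
        2 ^ (2 * b) * 2 ^ (2 * a + 2 * a)  ≡⟨ ^-distribˡ-+-* 2 (2 * b) (2 * a + 2 * a) ⟨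
        2 ^ (2 * b + (2 * a + 2 * a))      ≡⟨ cong (λ k → 2 ^ (2 * b + k)) (sym (*-distribʳ-+ a 2 2)) ⟩
        2 ^ (2 * b + 4 * a)                ∎
        where
        q≤ : q ^ b ≤ 4 ^ a
        q≤ = ≤-trans (<⇒≤ q<) (^-monoˡ-≤ a (n≤1+n 3))
      exponents : m * b < 2 * b + 4 * a
      exponents = ≰⇒> λ h → <⇒≱ powers (^-monoʳ-≤ 2 h)
      m<104 : m < 104
      m<104 = *-cancelˡ-< b m 104 (≤-cert 2 (+-mono-≤ (*-monoʳ-≤ 2 exponents) 8a<) (e₁ m b a))
        where
        e₁ : ∀ m b a → suc (b * m) + (2 * (2 * b + 4 * a) + b * (m + 100)) + 2 ≡ b * 104 + (2 * suc (m * b) + suc (8 * a))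
        e₁ = solve-∀

open Combinatorics

-- Arithmetic in the ordered field

module RealArithmetic {c ℓ₁ ℓ₂ : Level} (ℝ : RealNumbers c ℓ₁ ℓ₂) where
  open RealNumbers ℝ public
  open CommutativeRing commutativeRing public
    using (refl; sym; trans; reflexive; setoid; semiring; ring; 
           +-cong; +-congˡ; +-congʳ; +-assoc; +-comm; +-identityˡ; +-identityʳ; -‿inverseˡ; -‿inverseʳ;
           *-congˡ; *-congʳ; *-assoc; *-comm; *-identityˡ; *-identityʳ; distribˡ; distribʳ; zeroʳ)
  open IsStrictPartialOrder isStrictPartialOrder public
    using (<-respˡ-≈; <-respʳ-≈) renaming (irrefl to <-irrefl; trans to <-trans)
  open SemiringMult semiring public using (×-homo-+; ×-assocˡ; ×-assoc-*; ×1-homo-*; ×-congʳ) renaming (_×_ to _·_)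
  open SemiringSum semiring public
    using (sum-cong-≋; ∑-distrib-+; *-distribˡ-sum; *-distribʳ-sum)
  open RingProperties ring public using (-‿distribʳ-*)

  +-cancelʳ-< : ∀ z {x y} → x + z < y + z → x < y
  +-cancelʳ-< z h = <-respˡ-≈ (undo _) (<-respʳ-≈ (undo _) (+-monoˡ-< (- z) h))
    where
    undo : ∀ x → x + z + - z ≈ x
    undo x = trans (+-assoc x z (- z)) (trans (+-congˡ (-‿inverseʳ z)) (+-identityʳ x))

  ≤-reflexive : ∀ {x y} → x ≈ y → x ≤ y
  ≤-reflexive x≈y y<x = <-irrefl (sym x≈y) y<x

  -- As `≤` is a negated `<`, mixed transitivity has to be extracted from cotransitivity.
  <-≤-trans : ∀ {x y z} → x < y → y ≤ z → x < z
  <-≤-trans {z = z} x<y y≤z = [ (λ x<z → x<z) , (λ z<y → contradiction z<y y≤z) ]′ (cotransitive x<y z)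

  ≤-<-trans : ∀ {x y z} → x ≤ y → y < z → x < z
  ≤-<-trans {x} x≤y y<z = [ (λ y<x → contradiction y<x x≤y) , (λ x<z → x<z) ]′ (cotransitive y<z x)

  ≤-trans : ∀ {x y z} → x ≤ y → y ≤ z → x ≤ z
  ≤-trans x≤y y≤z z<x = y≤z (<-≤-trans z<x x≤y)

  <⇒≤ : ∀ {x y} → x < y → x ≤ y
  <⇒≤ x<y y<x = <-irrefl refl (<-trans x<y y<x)

  +-monoʳ-< : ∀ z {x y} → x < y → z + x < z + y
  +-monoʳ-< z {x} {y} h = <-respˡ-≈ (+-comm x z) (<-respʳ-≈ (+-comm y z) (+-monoˡ-< z h))

  +-monoˡ-≤ : ∀ z {x y} → x ≤ y → x + z ≤ y + z
  +-monoˡ-≤ z x≤y h = x≤y (+-cancelʳ-< z h)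

  +-mono-≤ : ∀ {x y u v} → x ≤ y → u ≤ v → x + u ≤ y + v
  +-mono-≤ {x} {y} {u} {v} x≤y u≤v = ≤-trans (+-monoˡ-≤ u x≤y)
    (≤-trans (≤-reflexive (+-comm y u)) (≤-trans (+-monoˡ-≤ y u≤v) (≤-reflexive (+-comm v y))))

  +-mono-<-≤ : ∀ {x y u v} → x < y → u ≤ v → x + u < y + v
  +-mono-<-≤ {y = y} {u} x<y u≤v = <-≤-trans (+-monoˡ-< u x<y) (+-mono-≤ (≤-reflexive refl) u≤v)

  +-mono-≤-< : ∀ {x y u v} → x ≤ y → u < v → x + u < y + v
  +-mono-≤-< {x} x≤y u<v = <-≤-trans (+-monoʳ-< x u<v) (+-mono-≤ x≤y (≤-reflexive refl))

  ·-nonneg : ∀ k {x} → 0# ≤ x → 0# ≤ k · x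
  ·-nonneg zero    0≤x = ≤-reflexive refl
  ·-nonneg (suc k) 0≤x = ≤-trans (≤-reflexive (sym (+-identityˡ 0#))) (+-mono-≤ 0≤x (·-nonneg k 0≤x))

  ·-monoˡ-≤ : ∀ {k l x} → 0# ≤ x → k ℕ.≤ l → k · x ≤ l · x
  ·-monoˡ-≤ {k} {l} {x} 0≤x k≤l with ℕ.m≤n⇒∃[o]m+o≡n k≤l
  ... | d , ≡.refl = ≤-trans (≤-reflexive (sym (+-identityʳ (k · x))))
    (≤-trans (+-mono-≤ (≤-reflexive refl) (·-nonneg d 0≤x)) (≤-reflexive (sym (×-homo-+ x k d))))

  ·-monoʳ-≤ : ∀ k {x y} → x ≤ y → k · x ≤ k · y
  ·-monoʳ-≤ zero    _   = ≤-reflexive refl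
  ·-monoʳ-≤ (suc k) x≤y = +-mono-≤ x≤y (·-monoʳ-≤ k x≤y)

  fromℕ-* : ∀ k x → fromℕ k * x ≈ k · x
  fromℕ-* k x = trans (×-assoc-* k 1# x) (×-congʳ k (*-identityˡ x))

  fromℕ-≤ : ∀ {k l} → k ℕ.≤ l → fromℕ k ≤ fromℕ l
  fromℕ-≤ = ·-monoˡ-≤ (<⇒≤ 0<1)

  fromℕ-< : ∀ {k l} → k ℕ.< l → fromℕ k < fromℕ l
  fromℕ-< {k} k<l = <-≤-trans (<-respˡ-≈ (+-identityˡ (fromℕ k)) (+-monoˡ-< (fromℕ k) 0<1)) (fromℕ-≤ k<l)

  fromℕ-≤⁻¹ : ∀ {k l} → fromℕ k ≤ fromℕ l → k ℕ.≤ l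
  fromℕ-≤⁻¹ h = ℕ.≮⇒≥ λ l<k → h (fromℕ-< l<k)

  fromℕ-pos : ∀ k → .{{NonZero k}} → 0# < fromℕ k
  fromℕ-pos (suc k) = fromℕ-< {0} {suc k} (ℕ.s≤s ℕ.z≤n)

  *-monoˡ-< : ∀ {x y z} → 0# < z → x < y → z * x < z * y
  *-monoˡ-< {x} {y} {z} 0<z x<y = +-cancelʳ-< (- (z * x))
    (<-respˡ-≈ (sym (-‿inverseʳ (z * x)))
      (<-respʳ-≈ (trans (distribˡ z y (- x)) (+-congˡ (sym (-‿distribʳ-* z x))))
        (*-pos 0<z (<-respˡ-≈ (-‿inverseʳ x) (+-monoˡ-< (- x) x<y)))))

  sum-mono : ∀ {k} {f g : Vector Carrier k} → (∀ j → f j ≤ g j) → sum f ≤ sum g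
  sum-mono {zero}  h = ≤-reflexive refl
  sum-mono {suc k} h = +-mono-≤ (h zero) (sum-mono (h ∘ suc))

  sum-mono-< : ∀ {k} {f g : Vector Carrier k} → (∀ j → f j ≤ g j) → ∀ j → f j < g j → sum f < sum g
  sum-mono-< h zero    fj<gj = +-mono-<-≤ fj<gj (sum-mono (h ∘ suc))
  sum-mono-< h (suc j) fj<gj = +-mono-≤-< (h zero) (sum-mono-< (h ∘ suc) j fj<gj)

  -- No case distinction on the sign of x is available. Comparing x with 0 < x + k · x yields either
  -- 0 < x or 0 < k · x, and the latter recurses.
  ·-pos⁻¹ : ∀ k {x} → 0# < k · x → 0# < x
  ·-pos⁻¹ zero    h = contradiction h (<-irrefl refl)
  ·-pos⁻¹ (suc k) {x} h = [ (λ 0<x → 0<x) , (λ x<x+kx → ·-pos⁻¹ k (+-cancelʳ-< x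
    (<-respˡ-≈ (sym (+-identityˡ x)) (<-respʳ-≈ (+-comm x (k · x)) x<x+kx)))) ]′ (cotransitive h x)

  reciprocal : ∀ k → .{{NonZero k}} → ∃ λ y → 0# < y × fromℕ k * y ≈ 1#
  reciprocal k with inverse (fromℕ-pos k)
  ... | y , eq = y , ·-pos⁻¹ k (<-respʳ-≈ (trans (sym eq) (fromℕ-* k y)) 0<1) , eq

  0≤1 : 0# ≤ 1#
  0≤1 = <⇒≤ 0<1

-- Convexity of polyhedra and closure under midpoints

module _ {c ℓ₁ ℓ₂ : Level} (ℝ : RealNumbers c ℓ₁ ℓ₂) where
  open RealArithmetic ℝ
  open import Relation.Binary.Reasoning.Setoid setoid

  lookup-zero : ∀ {A : Set} {n} (xs : Vec A (suc n)) → Vec.lookup xs zero ≡ head xs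
  lookup-zero (x ∷ xs) = ≡.refl

  lookup-suc : ∀ {A : Set} {n} (xs : Vec A (suc n)) i → Vec.lookup xs (suc i) ≡ Vec.lookup (tail xs) i
  lookup-suc (x ∷ xs) i = ≡.refl

  slope : Weight → Carrier
  slope w = fromℕ (w pos) - fromℕ (w zer)

  affine-value : ∀ {w} → Affine w → ∀ t → fromℕ (w t) ≈ fromℕ (w zer) + slope w * tritValue ℝ t
  affine-value {w} aff zer = sym (trans (+-congˡ (zeroʳ (slope w))) (+-identityʳ _))
  affine-value {w} aff pos = sym (begin
    fromℕ (w zer) + slope w * 1#                            ≈⟨ +-congˡ (*-identityʳ (slope w)) ⟩
    fromℕ (w zer) + (fromℕ (w pos) - fromℕ (w zer))         ≈⟨ add-sub (fromℕ (w zer)) (fromℕ (w pos)) ⟩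
    fromℕ (w pos)                                           ∎)
    where
    add-sub : ∀ a b → a + (b - a) ≈ b
    add-sub a b = trans (+-comm a (b - a)) (trans (+-assoc b (- a) a) (trans (+-congˡ (-‿inverseˡ a)) (+-identityʳ b)))
  affine-value {w} aff neg = sym (begin
    z + slope w * - 1#
      ≈⟨ +-congˡ (trans (sym (-‿distribʳ-* (slope w) 1#)) (-‿cong (*-identityʳ (slope w)))) ⟩
    z + - (p - z)                ≈⟨ +-congˡ (trans (sym (-‿+-comm p (- z))) (+-congˡ (-‿involutive z))) ⟩
    z + (- p + z)                ≈⟨ trans (+-congˡ (+-comm (- p) z)) (sym (+-assoc z z (- p))) ⟩
    z + z - p                    ≈⟨ +-congʳ sums ⟨
    q + p - p                    ≈⟨ trans (+-assoc q p (- p)) (trans (+-congˡ (-‿inverseʳ p)) (+-identityʳ q)) ⟩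
    q                            ∎)
    where
    open CommutativeRing commutativeRing using (-‿cong)
    open RingProperties ring using (-‿+-comm; -‿involutive)
    z = fromℕ (w zer)
    p = fromℕ (w pos)
    q = fromℕ (w neg)
    sums : q + p ≈ z + z
    sums = trans (sym (×-homo-+ 1# (w neg) (w pos))) (trans (reflexive (≡.cong fromℕ aff)) (×-homo-+ 1# (w zer) (w zer)))

  module _ {N} (coeff : Vector Carrier N) (coeff-sum : sum coeff ≈ 1#) where

    -- Constant parts are preserved because the coefficients sum to 1, linear parts because the
    -- combination holds in each coordinate.
    barycentre : ∀ {n} {ws : Vec Weight n} → VAll Affine ws → (point : Fin N → Point n) (x : Point n) →
      (∀ i → sum (λ j → coeff j * embed ℝ (point j) i) ≈ embed ℝ x i) →
      sum (λ j → coeff j * fromℕ (total ws (point j))) ≈ fromℕ (total ws x)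
    barycentre [] point x h = trans (sym (*-distribʳ-sum 0# coeff)) (zeroʳ (sum coeff))
    barycentre {ws = w ∷ ws} (aff ∷ affs) point x h = begin
      sum (λ j → coeff j * fromℕ (w (head (point j)) ℕ.+ total ws (tail (point j))))
        ≈⟨ sum-cong-≋ (λ j → trans (*-congˡ (trans (×-homo-+ 1# (w (head (point j))) _)
             (+-congʳ (affine-value {w} aff (head (point j)))))) (expand (coeff j) _ _ _ _)) ⟩
      sum (λ j → (constants j + linears j) + rests j)
        ≈⟨ trans (∑-distrib-+ (λ j → constants j + linears j) rests) (+-congʳ (∑-distrib-+ constants linears)) ⟩
      (sum constants + sum linears) + sum rests
        ≈⟨ +-cong (+-cong ∑-constants ∑-linears) (barycentre affs (tail ∘ point) (tail x) rest) ⟩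
      (α + β * tv (head x)) + fromℕ (total ws (tail x))
        ≈⟨ +-congʳ (affine-value {w} aff (head x)) ⟨
      fromℕ (w (head x)) + fromℕ (total ws (tail x))
        ≈⟨ ×-homo-+ 1# (w (head x)) _ ⟨
      fromℕ (total (w ∷ ws) x) ∎
      where
      tv = tritValue ℝ
      α = fromℕ (w zer)
      β = slope w
      constants linears rests : Vector Carrier N
      constants j = coeff j * α
      linears j   = β * (coeff j * tv (head (point j)))
      rests j     = coeff j * fromℕ (total ws (tail (point j)))
      expand : ∀ k a b t r → k * ((a + b * t) + r) ≈ (k * a + b * (k * t)) + k * r
      expand k a b t r = trans (distribˡ k (a + b * t) r) (+-congʳ (trans (distribˡ k a (b * t))
        (+-congˡ (trans (sym (*-assoc k b t)) (trans (*-congʳ (*-comm k b)) (*-assoc b k t))))))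
      ∑-constants : sum constants ≈ α
      ∑-constants = trans (sym (*-distribʳ-sum α coeff)) (trans (*-congʳ coeff-sum) (*-identityˡ α))
      value-zero : ∀ y → embed ℝ y zero ≈ tv (head y)
      value-zero y = reflexive (≡.cong tv (lookup-zero y))
      value-suc : ∀ y i → embed ℝ y (suc i) ≈ embed ℝ (tail y) i
      value-suc y i = reflexive (≡.cong tv (lookup-suc y i))
      ∑-linears : sum linears ≈ β * tv (head x)
      ∑-linears = trans (sym (*-distribˡ-sum β (λ j → coeff j * tv (head (point j)))))
        (*-congˡ (trans (sum-cong-≋ (λ j → *-congˡ (sym (value-zero (point j)))))
          (trans (h zero) (value-zero x))))
      rest : ∀ i → sum (λ j → coeff j * embed ℝ (tail (point j)) i) ≈ embed ℝ (tail x) i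
      rest i = trans (sum-cong-≋ (λ j → *-congˡ (sym (value-suc (point j) i)))) (trans (h (suc i)) (value-suc x i))

  halfspace-convex : ∀ {n} (h : Halfspace n) {S : CubeSet n} {x} → (∀ y → y ∈ S → Halfspace.Inside h y) →
    Conv ℝ S (embed ℝ x) → Halfspace.Inside h x
  halfspace-convex h {S} {x} inside conv = fromℕ-≤⁻¹ (≤-trans (≤-reflexive (sym weighted-bound))
    (≤-trans (sum-mono (λ j → ≤-trans (≤-reflexive (swap j bound)) (≤-trans (·-monoˡ-≤ (coeff≥0 j) (inside (point j) (point∈S j)))
      (≤-reflexive (sym (swap j (total weights (point j))))))))
      (≤-reflexive (barycentre coeff coeff-sum affine point x combination))))
    where
    open Conv conv
    open Halfspace h
    swap : ∀ j k → coeff j * fromℕ k ≈ k · coeff j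
    swap j k = trans (*-comm (coeff j) (fromℕ k)) (fromℕ-* k (coeff j))
    weighted-bound : sum (λ j → coeff j * fromℕ bound) ≈ fromℕ bound
    weighted-bound = trans (sym (*-distribʳ-sum (fromℕ bound) coeff)) (trans (*-congʳ coeff-sum) (*-identityˡ (fromℕ bound)))

  singleton-conv : ∀ {n} {S : CubeSet n} x → x ∈ S → Conv ℝ S (embed ℝ x)
  singleton-conv x x∈S = record
    { size        = 1
    ; point       = const x
    ; point∈S     = const x∈S
    ; coeff       = const 1#
    ; coeff≥0     = const 0≤1
    ; coeff-sum   = +-identityʳ 1#
    ; combination = λ i → trans (+-identityʳ _) (*-identityˡ _)
    }

  polyhedron-convex : ∀ {n} (hs : List (Halfspace n)) → Convex ℝ (polyhedron hs)
  polyhedron-convex hs x = mk⇔ (singleton-conv x) λ conv → fromWitness {a? = inside? hs x}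
    (All.tabulate λ {h} h∈hs → halfspace-convex h (λ y y∈ → All.lookup (toWitness {a? = inside? hs y} y∈) h∈hs) conv)

  convex⇒midpointClosed : ∀ {n m lo} {S : CubeSet n} → Convex ℝ S → Antislab.MidpointClosed n m lo S
  convex⇒midpointClosed {S = S} convex x y z mid x∈S y∈S = Equivalence.from (convex z) record
    { size        = 2
    ; point       = λ { zero → x ; (suc _) → y }
    ; point∈S     = λ { zero → x∈S ; (suc _) → y∈S }
    ; coeff       = const ½
    ; coeff≥0     = const (<⇒≤ (proj₁ (proj₂ (reciprocal 2))))
    ; coeff-sum   = trans (+-congˡ (+-identityʳ ½)) ½+½
    ; combination = λ i → trans (+-congˡ (+-identityʳ _)) (halves (mid i))
    }
    where
    ½ = proj₁ (reciprocal 2)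
    ½+½ : ½ + ½ ≈ 1#
    ½+½ = trans (+-congˡ (sym (+-identityʳ ½))) (trans (sym (fromℕ-* 2 ½)) (proj₂ (proj₂ (reciprocal 2))))
    halves : ∀ {t u w} → Midpoint t u w → ½ * tritValue ℝ t + ½ * tritValue ℝ u ≈ tritValue ℝ w
    halves same = trans (sym (distribʳ _ ½ ½)) (trans (*-congʳ ½+½) (*-identityˡ _))
    halves up   = trans (sym (distribˡ ½ _ _)) (trans (*-congˡ (-‿inverseʳ 1#)) (zeroʳ ½))
    halves down = trans (sym (distribˡ ½ _ _)) (trans (*-congˡ (-‿inverseˡ 1#)) (zeroʳ ½))

  -- Averaging over the outcomes of a randomized algorithm

  module _ {n} (A : NonAdaptive ℝ n) where
    open NonAdaptive A

    private
      p = prob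

    if-≤ : ∀ (event : Fin outcomes → Bool) j → (if event j then p j else 0#) ≤ p j
    if-≤ event j with event j
    ... | true  = ≤-reflexive refl
    ... | false = <⇒≤ (prob>0 j)

    -- Every outcome has positive weight, so missing one would push the probability strictly below
    -- the total 1.
    certain : ∀ event → Pr event ≈ 1# → ∀ j → event j ≡ true
    certain event Pr≈1 j with event j in eq
    ... | true  = ≡.refl
    ... | false = contradiction (sum-mono-< (if-≤ event) j missing) (<-irrefl (trans Pr≈1 (sym prob-sum)))
      where
      missing : (if event j then p j else 0#) < p j
      missing rewrite eq = prob>0 j

    size≤queryComplexity : ∀ j → Deterministic.size (algorithm j) ℕ.≤ queryComplexity
    size≤queryComplexity = ≤-foldr (Deterministic.size ∘ algorithm)
      where
      ≤-foldr : ∀ {k} (f : Fin k → ℕ) j → f j ℕ.≤ Vector.foldr ℕ._⊔_ 0 f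
      ≤-foldr f zero    = ℕ.m≤m⊔n _ _
      ≤-foldr f (suc j) = ℕ.≤-trans (≤-foldr (f ∘ suc) j) (ℕ.m≤n⊔m (f zero) _)

    ∑-Pr : ∀ {V : Set} (vs : List V) (event : V → Fin outcomes → Bool) {x} →
      (∀ v → fromℕ x ≤ fromℕ 3 * Pr (event v)) →
      fromℕ (length vs ℕ.* x) ≤ fromℕ 3 * sum (λ j → ∑ vs (λ v → ⟦ event v j ⟧) · p j)
    ∑-Pr []       event h = ≤-reflexive (sym (trans (*-congˡ (sum-zero outcomes)) (zeroʳ (fromℕ 3))))
      where
      sum-zero : ∀ k → sum {k} (const 0#) ≈ 0#
      sum-zero zero    = refl
      sum-zero (suc k) = trans (+-identityˡ _) (sum-zero k)
    ∑-Pr (v ∷ vs) event {x} h = ≤-trans (≤-reflexive (×-homo-+ 1# x (length vs ℕ.* x)))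
      (≤-trans (+-mono-≤ (h v) (∑-Pr vs event h)) (≤-reflexive (begin
        fromℕ 3 * Pr (event v) + fromℕ 3 * sum weights
          ≈⟨ distribˡ (fromℕ 3) (Pr (event v)) (sum weights) ⟨
        fromℕ 3 * (Pr (event v) + sum weights)
          ≈⟨ *-congˡ (∑-distrib-+ (λ j → if event v j then p j else 0#) weights) ⟨
        fromℕ 3 * sum (λ j → (if event v j then p j else 0#) + weights j)
          ≈⟨ *-congˡ (sum-cong-≋ (λ j → add (event v j) _ (p j))) ⟩
        fromℕ 3 * sum (λ j → (⟦ event v j ⟧ ℕ.+ ∑ vs (λ v → ⟦ event v j ⟧)) · p j) ∎)))
      where
      weights : Vector Carrier outcomes
      weights j = ∑ vs (λ v → ⟦ event v j ⟧) · p j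
      add : ∀ b k y → (if b then y else 0#) + k · y ≈ (⟦ b ⟧ ℕ.+ k) · y
      add true  k y = refl
      add false k y = +-identityˡ (k · y)

    sum-·-≤ : ∀ (r : Fin outcomes → ℕ) {L} → (∀ j → 2 ℕ.* r j ℕ.≤ L) → fromℕ 2 * sum (λ j → r j · p j) ≤ fromℕ L
    sum-·-≤ r {L} r≤ = ≤-trans (≤-reflexive (*-distribˡ-sum (fromℕ 2) (λ j → r j · p j)))
      (≤-trans (sum-mono (λ j → ≤-trans (≤-reflexive (trans (fromℕ-* 2 (r j · p j)) (×-assocˡ (p j) 2 (r j))))
          (≤-trans (·-monoˡ-≤ (<⇒≤ (prob>0 j)) (r≤ j)) (≤-reflexive (sym (fromℕ-* L (p j)))))))
        (≤-reflexive (trans (sym (*-distribˡ-sum (fromℕ L) p)) (trans (*-congˡ prob-sum) (*-identityʳ (fromℕ L))))))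

    -- Average over L sign vectors in two ways. Summed over the vectors, the rejection probabilities
    -- give at least 2L/3; summed over the outcomes, each rejecting at most half of the vectors,
    -- they give at most L/2. This is absurd for L > 0.
    not-all-rejected : ∀ {V : Set} (v : V) (vs : List V) (event : V → Fin outcomes → Bool) →
      (∀ v → fromℕ 2 ≤ fromℕ 3 * Pr (event v)) →
      ¬ (∀ j → 2 ℕ.* ∑ (v ∷ vs) (λ v → ⟦ event v j ⟧) ℕ.≤ length (v ∷ vs))
    not-all-rejected v vs event likely rare = ℕ.<⇒≱ 3L<4L (fromℕ-≤⁻¹ (≤-trans (≤-reflexive (×1-homo-* 2 (L ℕ.* 2)))
      (≤-trans (scale 2 (∑-Pr (v ∷ vs) event {2} likely)) (≤-trans (≤-reflexive (exchange (fromℕ 2) (fromℕ 3) _))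
        (≤-trans (scale 3 (sum-·-≤ (λ j → ∑ (v ∷ vs) (λ v → ⟦ event v j ⟧)) rare)) (≤-reflexive (sym (×1-homo-* 3 L))))))))
      where
      L = length (v ∷ vs)
      scale : ∀ k {x y} → x ≤ y → fromℕ k * x ≤ fromℕ k * y
      scale k {x} {y} h = ≤-trans (≤-reflexive (fromℕ-* k x)) (≤-trans (·-monoʳ-≤ k h) (≤-reflexive (sym (fromℕ-* k y))))
      exchange : ∀ x y z → x * (y * z) ≈ y * (x * z)
      exchange x y z = trans (sym (*-assoc x y z)) (trans (*-congʳ (*-comm x y)) (*-assoc y x z))
      3L<4L : 3 ℕ.* L ℕ.< 2 ℕ.* (L ℕ.* 2)
      3L<4L = ℕ.<-≤-trans (ℕ.*-monoˡ-< L (ℕ.n<1+n 3)) (ℕ.≤-reflexive (eq L))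
        where
        eq : ∀ L → 4 ℕ.* L ≡ 2 ℕ.* (L ℕ.* 2)
        eq = solve-∀

  -- Assembling the lower bound

  far-antislab : ∀ K {ε₀ ε} {n m lo} → fromℕ K * ε₀ ≈ 1# → ε ≤ ε₀ → .{{NonZero K}} →
    (∀ v S′ → Antislab.MidpointClosed n m lo S′ → 3 ℕ.^ n ℕ.≤ K ℕ.* ∣ Antislab.antislab n m lo v △ S′ ∣) →
    ∀ v → FarFromConvex ℝ ε (Antislab.antislab n m lo v)
  far-antislab K {ε₀} {ε} {n} {m} {lo} Kε₀≈1 ε≤ε₀ far v S′ convex close =
    fromℕ-≤ (far v S′ (convex⇒midpointClosed {m = m} {lo} convex)) (<-respˡ-≈ (sym (×1-homo-* K D))
      (<-respʳ-≈ (trans (sym (*-assoc (fromℕ K) ε₀ N)) (trans (*-congʳ Kε₀≈1) (*-identityˡ N)))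
        (*-monoˡ-< (fromℕ-pos K) (<-≤-trans close εN≤ε₀N))))
    where
    D = ∣ Antislab.antislab n m lo v △ S′ ∣
    N = fromℕ (3 ℕ.^ n)
    εN≤ε₀N : ε * N ≤ ε₀ * N
    εN≤ε₀N = ≤-trans (≤-reflexive (trans (*-comm ε N) (fromℕ-* (3 ℕ.^ n) ε)))
      (≤-trans (·-monoʳ-≤ (3 ℕ.^ n) ε≤ε₀) (≤-reflexive (sym (trans (*-comm ε₀ N) (fromℕ-* (3 ℕ.^ n) ε₀)))))

  many-queries : ∀ {n m lo ε} (A : NonAdaptive ℝ n) → OneSidedTester ℝ ε A →
    (∀ v → FarFromConvex ℝ ε (Antislab.antislab n m lo v)) →
    let q = NonAdaptive.queryComplexity A in ¬ (4 ℕ.* (q ℕ.* q) ℕ.≤ 2 ℕ.^ m)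
  many-queries {n} {m} {lo} A tester far few = no-outcome (allSigns n) (length-allSigns n) (λ j → rejections-rare {n} {m} {lo} (algorithm j)
      (λ hs → certain A (λ j → Deterministic.run (algorithm j) (polyhedron hs)) (accepts-convex _ (polyhedron-convex hs)) j)
      (size≤queryComplexity A j) few)
    where
    open NonAdaptive A
    open OneSidedTester tester
    event : Signs n → Fin outcomes → Bool
    event v j = not (Deterministic.run (algorithm j) (Antislab.antislab n m lo v))
    -- Generalising the list allows a split into head and tail; it cannot be empty because 2^n > 0.
    no-outcome : ∀ vs → length vs ≡ 2 ℕ.^ n → ¬ (∀ j → 2 ℕ.* ∑ vs (λ v → ⟦ event v j ⟧) ℕ.≤ 2 ℕ.^ n)
    no-outcome []       len rare = contradiction len (ℕ.<⇒≢ (ℕ.m^n>0 2 n))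
    no-outcome (v ∷ vs) len rare = not-all-rejected A v vs event (λ v → rejects-far _ (far v))
      λ j → ℕ.≤-trans (rare j) (ℕ.≤-reflexive (≡.sym len))

  scaled-root : ∀ {κ a b n} → fromℕ 8 * κ ≈ 1# →
    fromℕ (a ℕ.* a) ≤ (κ * κ) * fromℕ (b ℕ.* b ℕ.* n) → 64 ℕ.* square a ℕ.≤ square b ℕ.* n
  scaled-root {κ} {a} {b} {n} 8κ≈1 h = fromℕ-≤⁻¹ (≤-trans (≤-reflexive (trans (×1-homo-* 64 (a ℕ.* a)) (fromℕ-* 64 _)))
    (≤-trans (·-monoʳ-≤ 64 h) (≤-reflexive (begin
      64 · ((κ * κ) * B)                     ≈⟨ fromℕ-* 64 _ ⟨
      fromℕ 64 * ((κ * κ) * B)               ≈⟨ *-congʳ (×1-homo-* 8 8) ⟩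
      (fromℕ 8 * fromℕ 8) * ((κ * κ) * B)    ≈⟨ *-assoc _ (κ * κ) B ⟨
      (fromℕ 8 * fromℕ 8) * (κ * κ) * B
        ≈⟨ *-congʳ (trans (*-assoc (fromℕ 8) (fromℕ 8) (κ * κ)) (*-congˡ (trans (sym (*-assoc (fromℕ 8) κ κ)) (trans (*-congʳ 8κ≈1) (*-identityˡ κ))))) ⟩
      fromℕ 8 * κ * B                        ≈⟨ trans (*-congʳ 8κ≈1) (*-identityˡ B) ⟩
      B                                      ∎))))
    where
    B = fromℕ (b ℕ.* b ℕ.* n)

  FarConstant : ℕ → Set
  FarConstant K = ∀ {n m lo} → Scale n m lo → ∀ v S′ → Antislab.MidpointClosed n m lo S′ →
    3 ℕ.^ n ℕ.≤ K ℕ.* ∣ Antislab.antislab n m lo v △ S′ ∣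

  scaled-bound : ∀ K {ε₀ ε κ n} → .{{NonZero K}} → FarConstant K →
    fromℕ K * ε₀ ≈ 1# → ε ≤ ε₀ → fromℕ 8 * κ ≈ 1# → Scaled n →
    ∀ (A : NonAdaptive ℝ n) → OneSidedTester ℝ ε A → AtLeast3^√ ℝ κ n (NonAdaptive.queryComplexity A)
  scaled-bound K {κ = κ} {n} far Kε₀≈1 ε≤ε₀ 8κ≈1 record { m = m ; lo = lo ; scale = scale ; m≥ = m≥ ; n< = n< } A tester a b h =
    ℕ.≮⇒≥ λ q< → many-queries {n} {m} {lo} A tester (far-antislab K {m = m} {lo} Kε₀≈1 ε≤ε₀ (far scale))
      (few-queries {a} {b} {m} m≥ n< (scaled-root {κ} {a} {b} 8κ≈1 h) q<)

  -- The exponent 1000 is passed as a variable so that 6 · 2^1000, a unary number in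
  -- fromℕ, is never evaluated.
  lower-bound : ∀ k → k ≡ 1000 →
    ∃ λ (ε₀ : Carrier) → (0# < ε₀) × (∀ (ε : Carrier) → 0# < ε → ε ≤ ε₀ →
      ∃ λ (κ : Carrier) → (0# < κ) × ∃ λ (n₀ : ℕ) → ∀ (n : ℕ) → n₀ ℕ.≤ n →
        ∀ (A : NonAdaptive ℝ n) → OneSidedTester ℝ ε A → AtLeast3^√ ℝ κ n (NonAdaptive.queryComplexity A))
  -- The same κ = 1/8 and `n₀` serve every ε ≤ ε₀: the hard sets do not depend on ε, and being ε-far
  -- only becomes easier as ε decreases.
  lower-bound k k≡1000 = proj₁ 1/K , proj₁ (proj₂ 1/K) , λ ε _ ε≤ε₀ → proj₁ 1/8 , proj₁ (proj₂ 1/8) , n₀ , λ n n₀≤n →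
    scaled-bound K (λ scale v S′ closed → Farness.far scale v S′ closed k k≡1000)
      (proj₂ (proj₂ 1/K)) ε≤ε₀ (proj₂ (proj₂ 1/8)) (scaled n n₀≤n)
    where
    K = 6 ℕ.* 2 ℕ.^ k
    instance
      K≢0 : NonZero K
      K≢0 = ℕ.m*n≢0 6 (2 ℕ.^ k) {{_}} {{ℕ.m^n≢0 2 k}}
    1/K = reciprocal K
    1/8 = reciprocal 8

theorem1p10 : ∀ {c ℓ₁ ℓ₂ : Level} (ℝ : RealNumbers c ℓ₁ ℓ₂) →
    let open RealNumbers ℝ in
    ∃ λ (ε₀ : Carrier) → (0# < ε₀) ×
    (∀ (ε : Carrier) → 0# < ε → ε ≤ ε₀ →
    ∃ λ (κ : Carrier) → (0# < κ) ×
    ∃ λ (n₀ : ℕ) → ∀ (n : ℕ) → n₀ ℕ.≤ n →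
    ∀ (A : NonAdaptive ℝ n) → OneSidedTester ℝ ε A →
    AtLeast3^√ ℝ κ n (NonAdaptive.queryComplexity A))
theorem1p10 ℝ = lower-bound ℝ 1000 ≡.refl
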